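{- Let $\beta>1$ be a real number. If every $x\in I_\beta\cap\mathbb{Q}(\beta)$ has an eventually periodic $(-\beta)$-expansion $d_{ -\beta}(x)$, then $\beta$ is either a Pisot number or a Salem number.
   Context: For $\beta>1$ put $l_\beta=-\frac{\beta}{\beta+1}$, $r_\beta=\frac{1}{\beta+1}$ and $I_\beta=[l_\beta,r_\beta)$. Define $T:I_\beta\to I_\beta$ by $T(x)=-\beta x-\lfloor -\beta x-l_\beta\rfloor$. The $(-\beta)$-expansion of $x\in I_\beta$ is the infinite word $d_{ -\beta}(x)=x_1x_2x_3\cdots$ with $x_i=\lfloor -\beta T^{i-1}(x)-l_\beta\rfloor$ for $i\ge1$; then $x=\sum_{i\ge1}x_i(-\beta)^{ -i}$. $\mathbb{Q}(\beta)$ denotes the smallest subfield of $\mathbb{C}$ containing $\beta$. A Pisot number is an algebraic integer $\beta>1$ all of whose other conjugates have modulus $<1$; a Salem number is an algebraic integer $\beta>1$ all of whose other conjugates have modulus $\le1$ and which is not a Pisot number. -}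

module Defs where

open import Level using (0ℓ; suc)
open import Algebra.Bundles using (CommutativeRing)
open import Algebra.Bundles.Raw using (RawRing)
open import Axiom.ExcludedMiddle using (ExcludedMiddle)
open import Data.Empty using (⊥; ⊥-elim)
open import Data.Integer.Base as ℤ using (ℤ; +_; -[1+_])
open import Data.Nat.Base as ℕ using (ℕ; zero; NonZero)
open import Data.Nat.GeneralisedArithmetic using (fold)
open import Data.Product.Base using (_×_; _,_; proj₁; ∃; Σ-syntax)
open import Data.Rational.Base using (ℚ; ↥_; ↧_)
open import Data.Sum.Base using (inj₁; inj₂)
open import Data.Vec.Base using (Vec; []; _∷_)
open import Function.Base using (_∘_)
open import Relation.Binary.Core using (Rel)
open import Relation.Binary.Bundles using (StrictTotalOrder)
open import Relation.Binary.Definitions using (tri<; tri≈; tri>)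
open import Relation.Binary.PropositionalEquality.Core using (_≡_)
open import Relation.Binary.Structures using (IsStrictTotalOrder)
open import Relation.Nullary.Decidable.Core using (yes; no)
open import Relation.Nullary.Negation.Core using (¬_)

import Algebra.Definitions.RawMonoid as RawMonoidDefinitions
import Algebra.Properties.Ring as RingProperties
import Relation.Binary.Construct.StrictToNonStrict as StrictToNonStrict
import Relation.Binary.Reasoning.StrictPartialOrder as StrictReasoning

-- Classically, the real numbers are the complete ordered field, which is
-- unique up to isomorphism; they enter below as an arbitrary one.

record CompleteOrderedField : Set (suc 0ℓ) where
  infix 4 _<_
  field
    commutativeRing : CommutativeRing 0ℓ 0ℓ

  open CommutativeRing commutativeRing public

  field
    _<_                : Rel Carrier 0ℓ
    isStrictTotalOrder : IsStrictTotalOrder _≈_ _<_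

  open IsStrictTotalOrder isStrictTotalOrder public
    using (compare; <-resp-≈)
    renaming (trans to <-trans; irrefl to <-irrefl; asym to <-asym)
  open StrictToNonStrict _≈_ _<_ public using (_≤_)

  UpperBound : (Carrier → Set) → Carrier → Set
  UpperBound P b = ∀ x → P x → x ≤ b

  LeastUpperBound : (Carrier → Set) → Carrier → Set
  LeastUpperBound P s = UpperBound P s × (∀ b → UpperBound P b → s ≤ b)

  field
    1≉0       : ¬ 1# ≈ 0#
    inverse   : ∀ x → ¬ x ≈ 0# → ∃ λ y → x * y ≈ 1#
    +-monoˡ-< : ∀ {x y} z → x < y → x + z < y + z
    *-pos     : ∀ {x y} → 0# < x → 0# < y → 0# < x * y
    complete  : (P : Carrier → Set) → ∃ P → ∃ (UpperBound P) →
                ∃ (LeastUpperBound P)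

  -- The value at zero is a convention.
  infix 8 _⁻¹
  _⁻¹ : Carrier → Carrier
  x ⁻¹ with compare x 0#
  ... | tri< _ x≉0 _ = proj₁ (inverse x x≉0)
  ... | tri≈ _ _ _   = 0#
  ... | tri> _ x≉0 _ = proj₁ (inverse x x≉0)

  infixl 7 _/_
  _/_ : Carrier → Carrier → Carrier
  x / y = x * y ⁻¹

  fromℕ : ℕ → Carrier
  fromℕ n = RawMonoidDefinitions._×_ +-rawMonoid n 1#

  fromℤ : ℤ → Carrier
  fromℤ (+ n)    = fromℕ n
  fromℤ -[1+ n ] = - fromℕ (ℕ.suc n)

  fromℚ : ℚ → Carrier
  fromℚ q = fromℤ (↥ q) / fromℤ (↧ q)

  strictTotalOrder : StrictTotalOrder 0ℓ 0ℓ 0ℓ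
  strictTotalOrder = record { isStrictTotalOrder = isStrictTotalOrder }

module OrderedFieldProperties (ℝ : CompleteOrderedField) where
  open CompleteOrderedField ℝ
  open RingProperties ring public
    using (-‿involutive; -0#≈0#; -‿distribˡ-*; -‿distribʳ-*)
  open StrictReasoning (StrictTotalOrder.strictPartialOrder strictTotalOrder)

  +-monoʳ-< : ∀ {x y} z → x < y → z + x < z + y
  +-monoʳ-< {x} {y} z x<y = begin-strict
    z + x ≈⟨ +-comm z x ⟩
    x + z <⟨ +-monoˡ-< z x<y ⟩
    y + z ≈⟨ +-comm y z ⟩
    z + y ∎

  +-monoˡ-≤ : ∀ {x y} z → x ≤ y → x + z ≤ y + z
  +-monoˡ-≤ z (inj₁ x<y) = inj₁ (+-monoˡ-< z x<y)
  +-monoˡ-≤ z (inj₂ x≈y) = inj₂ (+-congʳ x≈y)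

  ≤⇒≯ : ∀ {x y} → x ≤ y → ¬ y < x
  ≤⇒≯ (inj₁ x<y) y<x = <-asym x<y y<x
  ≤⇒≯ (inj₂ x≈y) y<x = <-irrefl (sym x≈y) y<x

  ≮⇒≥ : ∀ {x y} → ¬ x < y → y ≤ x
  ≮⇒≥ {x} {y} x≮y with compare x y
  ... | tri< x<y _ _ = ⊥-elim (x≮y x<y)
  ... | tri≈ _ x≈y _ = inj₂ (sym x≈y)
  ... | tri> _ _ y<x = inj₁ y<x

  x+y-y≈x : ∀ x y → (x + y) + - y ≈ x
  x+y-y≈x x y = trans (+-assoc x y (- y)) (trans (+-congˡ (-‿inverseʳ y)) (+-identityʳ x))

  x-y+y≈x : ∀ x y → (x + - y) + y ≈ x
  x-y+y≈x x y = trans (+-assoc x (- y) y) (trans (+-congˡ (-‿inverseˡ y)) (+-identityʳ x))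

  neg-pos : ∀ {x} → x < 0# → 0# < - x
  neg-pos {x} x<0 = begin-strict
    0#      ≈⟨ -‿inverseʳ x ⟨
    x + - x <⟨ +-monoˡ-< (- x) x<0 ⟩
    0# + - x ≈⟨ +-identityˡ (- x) ⟩
    - x     ∎

  neg-mono-< : ∀ {x y} → x < y → - y < - x
  neg-mono-< {x} {y} x<y = begin-strict
    - y               ≈⟨ x+y-y≈x (- y) x ⟨
    (- y + x) + - x   ≈⟨ +-congʳ (+-comm (- y) x) ⟩
    (x + - y) + - x   <⟨ +-monoˡ-< (- x) (+-monoˡ-< (- y) x<y) ⟩
    (y + - y) + - x   ≈⟨ +-congʳ (-‿inverseʳ y) ⟩
    0# + - x          ≈⟨ +-identityˡ (- x) ⟩
    - x               ∎

  square-neg : ∀ x → - x * - x ≈ x * x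
  square-neg x = begin-equality
    - x * - x     ≈⟨ -‿distribˡ-* x (- x) ⟨
    - (x * - x)   ≈⟨ -‿cong (-‿distribʳ-* x x) ⟨
    - - (x * x)   ≈⟨ -‿involutive (x * x) ⟩
    x * x         ∎

  0≤x² : ∀ x → 0# ≤ x * x
  0≤x² x with compare x 0#
  ... | tri< x<0 _ _ = inj₁ (begin-strict
    0#        <⟨ *-pos (neg-pos x<0) (neg-pos x<0) ⟩
    - x * - x ≈⟨ square-neg x ⟩
    x * x     ∎)
  ... | tri≈ _ x≈0 _ = inj₂ (sym (trans (*-congʳ x≈0) (zeroˡ x)))
  ... | tri> _ _ 0<x = inj₁ (*-pos 0<x 0<x)

  0≤x+y : ∀ {x y} → 0# ≤ x → 0# ≤ y → 0# ≤ x + y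
  0≤x+y {x} {y} 0≤x 0≤y = begin
    0#      ≤⟨ 0≤y ⟩
    y       ≈⟨ +-identityˡ y ⟨
    0# + y  ≤⟨ +-monoˡ-≤ y 0≤x ⟩
    x + y   ∎

  0<1 : 0# < 1#
  0<1 with 0≤x² 1#
  ... | inj₁ 0<1² = begin-strict
    0# <⟨ 0<1² ⟩ 1# * 1# ≈⟨ *-identityˡ 1# ⟩ 1# ∎
  ... | inj₂ 0≈1² = ⊥-elim (1≉0 (sym (trans 0≈1² (*-identityˡ 1#))))

  x<x+1 : ∀ x → x < x + 1#
  x<x+1 x = begin-strict
    x      ≈⟨ +-identityʳ x ⟨
    x + 0# <⟨ +-monoʳ-< x 0<1 ⟩
    x + 1# ∎

  x-1<x : ∀ x → x + - 1# < x
  x-1<x x = begin-strict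
    x + - 1#        <⟨ x<x+1 _ ⟩
    (x + - 1#) + 1# ≈⟨ x-y+y≈x x 1# ⟩
    x               ∎

  fromℤ-suc : ∀ k → fromℤ (ℤ.suc k) ≈ fromℤ k + 1#
  fromℤ-suc (+ n)             = +-comm 1# (fromℕ n)
  fromℤ-suc -[1+ zero ]       = sym (trans (+-congʳ (-‿cong (+-identityʳ 1#))) (-‿inverseˡ 1#))
  fromℤ-suc -[1+ ℕ.suc n ]    = sym (begin-equality
    - (1# + m) + 1#         ≈⟨ +-congʳ (-‿cong (+-comm 1# m)) ⟩
    - (m + 1#) + 1#         ≈⟨ +-congˡ (x+y-y≈x 1# m) ⟨
    - (m + 1#) + ((1# + m) + - m) ≈⟨ +-assoc _ _ _ ⟨
    (- (m + 1#) + (1# + m)) + - m ≈⟨ +-congʳ (+-congˡ (+-comm 1# m)) ⟩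
    (- (m + 1#) + (m + 1#)) + - m ≈⟨ +-congʳ (-‿inverseˡ (m + 1#)) ⟩
    0# + - m                ≈⟨ +-identityˡ (- m) ⟩
    - m                     ∎)
    where m = fromℕ (ℕ.suc n)

  square-bound : ∀ {x t} → t * t ≤ x → t ≤ x + 1#
  square-bound {x} {t} t²≤x = ≮⇒≥ λ x+1<t →
    let
      0≤x : 0# ≤ x
      0≤x = begin 0# ≤⟨ 0≤x² t ⟩ t * t ≤⟨ t²≤x ⟩ x ∎
      1<t : 1# < t
      1<t = begin-strict
        1#      ≈⟨ +-identityˡ 1# ⟨
        0# + 1# ≤⟨ +-monoˡ-≤ 1# 0≤x ⟩
        x + 1#  <⟨ x+1<t ⟩
        t       ∎
      0<t-1 : 0# < t + - 1#
      0<t-1 = begin-strict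
        0#        ≈⟨ -‿inverseʳ 1# ⟨
        1# + - 1# <⟨ +-monoˡ-< (- 1#) 1<t ⟩
        t + - 1#  ∎
      t<t² : t < t * t
      t<t² = begin-strict
        t                       ≈⟨ +-identityˡ t ⟨
        0# + t                  <⟨ +-monoˡ-< t (*-pos (<-trans 0<1 1<t) 0<t-1) ⟩
        t * (t + - 1#) + t      ≈⟨ +-congˡ (*-identityʳ t) ⟨
        t * (t + - 1#) + t * 1# ≈⟨ distribˡ t _ 1# ⟨
        t * ((t + - 1#) + 1#)   ≈⟨ *-congˡ (x-y+y≈x t 1#) ⟩
        t * t                   ∎
    in <-irrefl refl (begin-strict
         x      <⟨ x<x+1 x ⟩
         x + 1# <⟨ x+1<t ⟩
         t      <⟨ t<t² ⟩
         t * t  ≤⟨ t²≤x ⟩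
         x      ∎)

  -- The square root of x is the supremum of { t ∣ t² ≤ x }.
  √ : ∀ x → 0# ≤ x → Carrier
  √ x 0≤x = proj₁ (complete (λ t → t * t ≤ x)
    (0# , (begin 0# * 0# ≈⟨ zeroˡ 0# ⟩ 0# ≤⟨ 0≤x ⟩ x ∎))
    (x + 1# , λ _ → square-bound))

-- Classical logic is needed to extract an integer from completeness.
module Floor (em : ExcludedMiddle 0ℓ) (ℝ : CompleteOrderedField) where
  open CompleteOrderedField ℝ
  open OrderedFieldProperties ℝ
  open StrictReasoning (StrictTotalOrder.strictPartialOrder strictTotalOrder)

  archimedean : ∀ x → ∃ λ n → x < fromℕ n
  archimedean x with em {P = ∃ λ n → x < fromℕ n}
  ... | yes p = p
  ... | no ¬p = ⊥-elim (absurd (complete IsNatural (0# , 0 , refl) (x , bound)))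
    where
    IsNatural : Carrier → Set
    IsNatural y = ∃ λ n → y ≈ fromℕ n

    bound : UpperBound IsNatural x
    bound y (n , y≈n) = begin
      y       ≈⟨ y≈n ⟩
      fromℕ n ≤⟨ ≮⇒≥ (λ x<n → ¬p (n , x<n)) ⟩
      x       ∎

    absurd : ∃ (LeastUpperBound IsNatural) → ⊥
    absurd (s , ub , least) = ≤⇒≯ (least (s + - 1#) smaller) (x-1<x s)
      where
      smaller : UpperBound IsNatural (s + - 1#)
      smaller y (n , y≈n) = begin
        y                     ≈⟨ x+y-y≈x y 1# ⟨
        (y + 1#) + - 1#       ≤⟨ +-monoˡ-≤ (- 1#) (ub (y + 1#)
                                   (ℕ.suc n , trans (+-comm y 1#) (+-congˡ y≈n))) ⟩
        s + - 1#              ∎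

  IsFloor : Carrier → ℤ → Set
  IsFloor x k = fromℤ k ≤ x × x < fromℤ k + 1#

  floor : ∀ x → ∃ (IsFloor x)
  floor x with archimedean (- x)
  ... | m , -x<m with archimedean (x + fromℕ m)
  ... | n , x+m<n = search n (ℤ.- + m) (inj₁ -m<x) x<-m+n
    where
    -m≈ : ∀ k → fromℤ (ℤ.- + k) ≈ - fromℕ k
    -m≈ zero        = sym -0#≈0#
    -m≈ (ℕ.suc k)   = refl

    -m<x : fromℤ (ℤ.- + m) < x
    -m<x = begin-strict
      fromℤ (ℤ.- + m) ≈⟨ -m≈ m ⟩
      - fromℕ m       <⟨ neg-mono-< -x<m ⟩
      - - x           ≈⟨ -‿involutive x ⟩
      x               ∎

    x<-m+n : x < fromℤ (ℤ.- + m) + fromℕ n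
    x<-m+n = begin-strict
      x                              ≈⟨ x+y-y≈x x (fromℕ m) ⟨
      (x + fromℕ m) + - fromℕ m      <⟨ +-monoˡ-< _ x+m<n ⟩
      fromℕ n + - fromℕ m            ≈⟨ +-comm _ _ ⟩
      - fromℕ m + fromℕ n            ≈⟨ +-congʳ (-m≈ m) ⟨
      fromℤ (ℤ.- + m) + fromℕ n      ∎

    search : ∀ n k → fromℤ k ≤ x → x < fromℤ k + fromℕ n → ∃ (IsFloor x)
    search zero k k≤x x<k+0 = ⊥-elim (≤⇒≯ k≤x (begin-strict
      x              <⟨ x<k+0 ⟩
      fromℤ k + 0#   ≈⟨ +-identityʳ _ ⟩
      fromℤ k        ∎))
    search (ℕ.suc n) k k≤x x<k+1+n with em {P = x < fromℤ k + 1#}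
    ... | yes x<k+1 = k , k≤x , x<k+1
    ... | no  x≮k+1 = search n (ℤ.suc k)
      (begin
        fromℤ (ℤ.suc k) ≈⟨ fromℤ-suc k ⟩
        fromℤ k + 1#    ≤⟨ ≮⇒≥ x≮k+1 ⟩
        x               ∎)
      (begin-strict
        x                             <⟨ x<k+1+n ⟩
        fromℤ k + (1# + fromℕ n)      ≈⟨ +-assoc _ _ _ ⟨
        (fromℤ k + 1#) + fromℕ n      ≈⟨ +-congʳ (fromℤ-suc k) ⟨
        fromℤ (ℤ.suc k) + fromℕ n     ∎)

  ⌊_⌋ : Carrier → ℤ
  ⌊ x ⌋ = proj₁ (floor x)

module ComplexNumbers (ℝ : CompleteOrderedField) where
  open CompleteOrderedField ℝ
  open OrderedFieldProperties ℝ

  ℂ : RawRing 0ℓ 0ℓ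
  ℂ = record
    { Carrier = Carrier × Carrier
    ; _≈_     = λ (a , b) (c , d) → a ≈ c × b ≈ d
    ; _+_     = λ (a , b) (c , d) → a + c , b + d
    ; _*_     = λ (a , b) (c , d) → a * c + - (b * d) , a * d + b * c
    ; -_      = λ (a , b) → - a , - b
    ; 0#      = 0# , 0#
    ; 1#      = 1# , 0#
    }

  module ℂ = RawRing ℂ

  fromReal : Carrier → ℂ.Carrier
  fromReal x = x , 0#

  ∣_∣ : ℂ.Carrier → Carrier
  ∣ a , b ∣ = √ (a * a + b * b) (0≤x+y (0≤x² a) (0≤x² b))

  record IsSubfield (K : ℂ.Carrier → Set) : Set where
    field
      resp-≈   : ∀ {z w} → z ℂ.≈ w → K z → K w
      0∈       : K ℂ.0#
      1∈       : K ℂ.1#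
      +-closed : ∀ {z w} → K z → K w → K (z ℂ.+ w)
      *-closed : ∀ {z w} → K z → K w → K (z ℂ.* w)
      neg-closed : ∀ {z} → K z → K (ℂ.- z)
      inv-closed : ∀ {z w} → z ℂ.* w ℂ.≈ ℂ.1# → K z → K w

  -- The intersection of all subfields of ℂ containing β.
  _∈ℚ⟨_⟩ : ℂ.Carrier → ℂ.Carrier → Set (suc 0ℓ)
  z ∈ℚ⟨ β ⟩ = (K : ℂ.Carrier → Set) → IsSubfield K → K β → K z

-- c₀ ∷ ⋯ ∷ cₙ₋₁ ∷ [] encodes the monic polynomial
-- Xⁿ + cₙ₋₁ Xⁿ⁻¹ + ⋯ + c₀ of degree n.
Monic : Set → ℕ → Set
Monic = Vec

module Evaluation (K : RawRing 0ℓ 0ℓ) where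
  open RawRing K

  -- ι interprets the coefficients.
  eval : ∀ {A n} → (A → Carrier) → Monic A n → Carrier → Carrier
  eval ι []      x = 1#
  eval ι (c ∷ p) x = ι c + x * eval ι p x

module AlgebraicNumbers (ℝ : CompleteOrderedField) where
  open CompleteOrderedField ℝ
  open ComplexNumbers ℝ
  open Evaluation rawRing using () renaming (eval to evalℝ)
  open Evaluation ℂ using () renaming (eval to evalℂ)

  IsAlgebraicInteger : Carrier → Set
  IsAlgebraicInteger β =
    ∃ λ n → Σ[ p ∈ Monic ℤ n ] evalℝ fromℤ p β ≈ 0#

  IsMinimalPolynomial : ∀ {n} → Monic ℚ n → Carrier → Set
  IsMinimalPolynomial {n} p β =
    evalℝ fromℚ p β ≈ 0# ×
    (∀ {m} (q : Monic ℚ m) → evalℝ fromℚ q β ≈ 0# → n ℕ.≤ m)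

  IsConjugate : ℂ.Carrier → Carrier → Set
  IsConjugate γ β = ∃ λ n → Σ[ p ∈ Monic ℚ n ]
    (IsMinimalPolynomial p β × evalℂ (fromReal ∘ fromℚ) p γ ℂ.≈ ℂ.0#)

  IsOtherConjugate : ℂ.Carrier → Carrier → Set
  IsOtherConjugate γ β = IsConjugate γ β × ¬ γ ℂ.≈ fromReal β

  IsPisot : Carrier → Set
  IsPisot β = IsAlgebraicInteger β × 1# < β ×
    (∀ γ → IsOtherConjugate γ β → ∣ γ ∣ < 1#)

  IsSalem : Carrier → Set
  IsSalem β = IsAlgebraicInteger β × 1# < β ×
    (∀ γ → IsOtherConjugate γ β → ∣ γ ∣ ≤ 1#) × ¬ IsPisot β

module NegativeBase (em : ExcludedMiddle 0ℓ) (ℝ : CompleteOrderedField)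
                    (β : CompleteOrderedField.Carrier ℝ) where
  open CompleteOrderedField ℝ
  open Floor em ℝ

  l r : Carrier
  l = - (β / (β + 1#))
  r = 1# / (β + 1#)

  _∈I : Carrier → Set
  x ∈I = l ≤ x × x < r

  digit : Carrier → ℤ
  digit x = ⌊ - β * x - l ⌋

  -- Given by its formula on all of ℝ; it maps ℝ, hence I, into I.
  T : Carrier → Carrier
  T x = - β * x - fromℤ (digit x)

  -- Indexed from zero: d x i is the digit with index i + 1.
  d : Carrier → ℕ → ℤ
  d x i = digit (fold x T i)

EventuallyPeriodic : {A : Set} → (ℕ → A) → Set
EventuallyPeriodic u =
  ∃ λ m → ∃ λ p → NonZero p × (∀ n → m ℕ.≤ n → u (n ℕ.+ p) ≡ u n)

{-# OPTIONS --safe #-}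
module Submission where

-- Periodic digits make the orbit T^k(x) periodic: the difference of T^(m+p)(x) and T^m(x) is
-- multiplied by −β at each later step while staying bounded, so it vanishes. For x = l_β, the
-- number (β + 1) T^k(l_β) is ± a monic integer polynomial of degree k + 1 in β, and
-- T^(m+p)(l_β) = T^m(l_β) makes β an algebraic integer.
--
-- Let γ ≠ β be a conjugate with |γ| > 1, and let x ↦ x′ be the field embedding ℚ(β) → ℂ with
-- β′ = γ. The conjugate orbit z₀ = x′, z_(k+1) = −γ z_k − d_k is periodic when x has a periodic
-- expansion, but |z_k| is strictly increasing as soon as |x′| exceeds a constant, because the
-- digits are bounded. Such an x is Nβ − j with j chosen so that x ∈ I_β, since
-- x′ = N(γ − β) + x. So no other conjugate lies outside the closed unit disc.

open import Defs
open import Level using (0ℓ)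
open import Algebra.Bundles using (CommutativeRing)
open import Algebra.Bundles.Raw using (RawRing)
open import Algebra.Solver.Ring.AlmostCommutativeRing
  using (fromCommutativeRing; _-Raw-AlmostCommutative⟶_)
open import Algebra.Structures using (IsCommutativeRing)
open import Axiom.ExcludedMiddle using (ExcludedMiddle)
open import Data.Empty using (⊥-elim)
open import Data.Integer.Base as ℤ using (ℤ; +_; -[1+_])
open import Data.Maybe.Base using (Maybe; just; nothing)
open import Data.Nat.Base as ℕ using (ℕ; zero; suc; z≤n; s≤s)
open import Data.Nat.GeneralisedArithmetic using (fold)
open import Data.Product.Base using (_×_; _,_; proj₁; proj₂; ∃; Σ-syntax)
open import Data.Rational.Base as ℚ using (ℚ; 0ℚ; 1ℚ; mkℚ; toℚᵘ)
open import Data.Rational.Unnormalised.Base as ℚᵘ using (ℚᵘ; mkℚᵘ; *≡*)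
open import Data.Sum.Base using (_⊎_; inj₁; inj₂; map₂)
open import Data.Vec.Base using (Vec; []; _∷_; zipWith; replicate; padRight)
open import Function.Base using (_∘_)
open import Relation.Binary.Bundles using (StrictTotalOrder)
open import Relation.Binary.Definitions using (tri<; tri≈; tri>)
open import Relation.Binary.PropositionalEquality as ≡ using (_≡_; _≢_)
open import Relation.Nullary.Decidable.Core using (yes; no; toSum)
open import Relation.Nullary.Negation.Core using (¬_)

import Algebra.Properties.AbelianGroup as AbelianGroupProperties
import Algebra.Properties.Monoid.Mult.TCOptimised as OptimisedMultiples
import Algebra.Properties.Ring as RingProperties
import Algebra.Properties.Semiring.Exp as Exponentiation
import Algebra.Properties.Semiring.Mult as Multiples
import Algebra.Solver.Ring as RingSolver
import Data.Integer.Properties as ℤ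
import Data.Nat.Coprimality as Coprimality
import Data.Nat.Properties as ℕ
import Data.Rational.Properties as ℚ
import Relation.Binary.Reasoning.Setoid as SetoidReasoning
import Relation.Binary.Reasoning.StrictPartialOrder as StrictReasoning

-- The map from ℤ to a commutative ring, and a ring solver with integer coefficients

module IntegerCoefficients (R : CommutativeRing 0ℓ 0ℓ) where
  open CommutativeRing R
  open RingProperties ring using (-0#≈0#; -‿involutive; -‿distribˡ-*)
  open AbelianGroupProperties +-abelianGroup using () renaming (⁻¹-∙-comm to -‿+-comm)
  open Multiples semiring using (×-homo-+; ×1-homo-*) renaming (_×_ to _·_)
  open SetoidReasoning setoid

  ι : ℤ → Carrier
  ι (+ n)    = n · 1#
  ι -[1+ n ] = - (suc n · 1#)

  ι-⊖ : ∀ m n → ι (m ℤ.⊖ n) ≈ m · 1# + - (n · 1#)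
  ι-⊖ m zero = begin
    m · 1#         ≈⟨ +-identityʳ _ ⟨
    m · 1# + 0#    ≈⟨ +-congˡ -0#≈0# ⟨
    m · 1# + - 0#  ∎
  ι-⊖ zero (suc n) = sym (+-identityˡ _)
  ι-⊖ (suc m) (suc n) = begin
    ι (suc m ℤ.⊖ suc n)  ≡⟨ ≡.cong ι (ℤ.[1+m]⊖[1+n]≡m⊖n m n) ⟩
    ι (m ℤ.⊖ n)          ≈⟨ ι-⊖ m n ⟩
    a + - b              ≈⟨ +-congʳ (+-identityʳ a) ⟨
    a + 0# + - b         ≈⟨ +-congʳ (+-congˡ (-‿inverseʳ 1#)) ⟨
    a + (1# + - 1#) + - b  ≈⟨ +-congʳ (+-assoc a 1# (- 1#)) ⟨
    a + 1# + - 1# + - b    ≈⟨ +-assoc _ _ _ ⟩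
    a + 1# + (- 1# + - b)  ≈⟨ +-cong (+-comm a 1#) (-‿+-comm 1# b) ⟩
    1# + a + - (1# + b)    ∎
    where
    a = m · 1#
    b = n · 1#

  ι-+ : ∀ i j → ι (i ℤ.+ j) ≈ ι i + ι j
  ι-+ (+ m)    (+ n)    = ×-homo-+ 1# m n
  ι-+ (+ m)    -[1+ n ] = ι-⊖ m (suc n)
  ι-+ -[1+ m ] (+ n)    = trans (ι-⊖ n (suc m)) (+-comm _ _)
  ι-+ -[1+ m ] -[1+ n ] = begin
    - (suc (suc (m ℕ.+ n)) · 1#)     ≡⟨ ≡.cong (λ k → - (suc k · 1#)) (ℕ.+-suc m n) ⟨
    - ((suc m ℕ.+ suc n) · 1#)       ≈⟨ -‿cong (×-homo-+ 1# (suc m) (suc n)) ⟩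
    - (suc m · 1# + suc n · 1#)      ≈⟨ -‿+-comm _ _ ⟨
    - (suc m · 1#) + - (suc n · 1#)  ∎

  ι-neg : ∀ i → ι (ℤ.- i) ≈ - ι i
  ι-neg (+ zero)  = sym -0#≈0#
  ι-neg (+ suc n) = refl
  ι-neg -[1+ n ]  = sym (-‿involutive _)

  ι-*-nonNeg : ∀ m j → ι (+ m ℤ.* j) ≈ ι (+ m) * ι j
  ι-*-nonNeg m (+ n) = begin
    ι (+ m ℤ.* + n)  ≡⟨ ≡.cong ι (ℤ.pos-* m n) ⟨
    (m ℕ.* n) · 1#   ≈⟨ ×1-homo-* m n ⟩
    ι (+ m) * ι (+ n) ∎
  ι-*-nonNeg m -[1+ n ] = begin
    ι (+ m ℤ.* ℤ.- + suc n)      ≡⟨ ≡.cong ι (ℤ.neg-distribʳ-* (+ m) (+ suc n)) ⟨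
    ι (ℤ.- (+ m ℤ.* + suc n))    ≈⟨ ι-neg (+ m ℤ.* + suc n) ⟩
    - ι (+ m ℤ.* + suc n)        ≈⟨ -‿cong (ι-*-nonNeg m (+ suc n)) ⟩
    - (ι (+ m) * ι (+ suc n))    ≈⟨ RingProperties.-‿distribʳ-* ring _ _ ⟩
    ι (+ m) * ι -[1+ n ]         ∎

  ι-* : ∀ i j → ι (i ℤ.* j) ≈ ι i * ι j
  ι-* (+ m)    j = ι-*-nonNeg m j
  ι-* -[1+ m ] j = begin
    ι (ℤ.- + suc m ℤ.* j)    ≡⟨ ≡.cong ι (ℤ.neg-distribˡ-* (+ suc m) j) ⟨
    ι (ℤ.- (+ suc m ℤ.* j))  ≈⟨ ι-neg (+ suc m ℤ.* j) ⟩
    - ι (+ suc m ℤ.* j)      ≈⟨ -‿cong (ι-*-nonNeg (suc m) j) ⟩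
    - (ι (+ suc m) * ι j)    ≈⟨ -‿distribˡ-* _ _ ⟩
    ι -[1+ m ] * ι j         ∎

  open OptimisedMultiples +-monoid using (×ᵤ≈×) renaming (_×_ to _·′_)

  -- Unlike ι, it sends 1 to 1# on the nose, so that solved equations may mention 1#.
  ι′ : ℤ → Carrier
  ι′ (+ n)    = n ·′ 1#
  ι′ -[1+ n ] = - (suc n ·′ 1#)

  ι≈ι′ : ∀ i → ι i ≈ ι′ i
  ι≈ι′ (+ n)    = ×ᵤ≈× n 1#
  ι≈ι′ -[1+ n ] = -‿cong (×ᵤ≈× (suc n) 1#)

  ι′-homomorphism : ℤ.+-*-rawRing -Raw-AlmostCommutative⟶ fromCommutativeRing R
  ι′-homomorphism = record
    { ⟦_⟧    = ι′
    ; +-homo = λ i j → trans (sym (ι≈ι′ (i ℤ.+ j))) (trans (ι-+ i j) (+-cong (ι≈ι′ i) (ι≈ι′ j)))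
    ; *-homo = λ i j → trans (sym (ι≈ι′ (i ℤ.* j))) (trans (ι-* i j) (*-cong (ι≈ι′ i) (ι≈ι′ j)))
    ; -‿homo = λ i → trans (sym (ι≈ι′ (ℤ.- i))) (trans (ι-neg i) (-‿cong (ι≈ι′ i)))
    ; 0-homo = refl
    ; 1-homo = refl
    }

  _coeff≟_ : ∀ i j → Maybe (ι′ i ≈ ι′ j)
  i coeff≟ j with i ℤ.≟ j
  ... | yes i≡j = just (reflexive (≡.cong ι′ i≡j))
  ... | no  _   = nothing

  open RingSolver ℤ.+-*-rawRing (fromCommutativeRing R) ι′-homomorphism _coeff≟_ public
    using (solve; con; _:+_; _:*_; :-_; _:=_)

-- Inequalities and cancellation in an ordered field

module OrderedField (ℝ : CompleteOrderedField) where
  open CompleteOrderedField ℝ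
  open OrderedFieldProperties ℝ
  open IntegerCoefficients commutativeRing
  open StrictReasoning (StrictTotalOrder.strictPartialOrder strictTotalOrder)

  -- With its weak form, the pattern for most estimates below: the difference of the two sides is
  -- written as a visibly positive expression, and the ring solver checks the identity.
  <-+ : ∀ {x y c} → 0# < c → y ≈ x + c → x < y
  <-+ {x} {y} {c} 0<c y≈ = begin-strict
    x       ≈⟨ +-identityʳ x ⟨
    x + 0#  <⟨ +-monoʳ-< x 0<c ⟩
    x + c   ≈⟨ y≈ ⟨
    y       ∎

  ≤-+ : ∀ {x y c} → 0# ≤ c → y ≈ x + c → x ≤ y
  ≤-+ (inj₁ 0<c) y≈ = inj₁ (<-+ 0<c y≈)
  ≤-+ (inj₂ 0≈c) y≈ = inj₂ (sym (trans y≈ (trans (+-congˡ (sym 0≈c)) (+-identityʳ _))))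

  ≤-trans : ∀ {x y z} → x ≤ y → y ≤ z → x ≤ z
  ≤-trans {x} {y} {z} x≤y y≤z = begin x ≤⟨ x≤y ⟩ y ≤⟨ y≤z ⟩ z ∎

  <-≤-trans : ∀ {x y z} → x < y → y ≤ z → x < z
  <-≤-trans {x} {y} {z} x<y y≤z = begin-strict x <⟨ x<y ⟩ y ≤⟨ y≤z ⟩ z ∎

  ≰⇒> : ∀ {x y} → ¬ x ≤ y → y < x
  ≰⇒> {x} {y} x≰y with compare x y
  ... | tri< x<y _ _ = ⊥-elim (x≰y (inj₁ x<y))
  ... | tri≈ _ x≈y _ = ⊥-elim (x≰y (inj₂ x≈y))
  ... | tri> _ _ y<x = y<x

  x<y⇒0<y-x : ∀ {x y} → x < y → 0# < y - x
  x<y⇒0<y-x {x} {y} x<y = begin-strict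
    0#     ≈⟨ -‿inverseʳ x ⟨
    x - x  <⟨ +-monoˡ-< (- x) x<y ⟩
    y - x  ∎

  x≤y⇒0≤y-x : ∀ {x y} → x ≤ y → 0# ≤ y - x
  x≤y⇒0≤y-x {x} {y} x≤y = begin
    0#     ≈⟨ -‿inverseʳ x ⟨
    x - x  ≤⟨ +-monoˡ-≤ (- x) x≤y ⟩
    y - x  ∎

  0≤x*y : ∀ {x y} → 0# ≤ x → 0# ≤ y → 0# ≤ x * y
  0≤x*y (inj₁ 0<x) (inj₁ 0<y) = inj₁ (*-pos 0<x 0<y)
  0≤x*y {x} {y} (inj₁ _) (inj₂ 0≈y) = inj₂ (sym (trans (*-congˡ (sym 0≈y)) (zeroʳ x)))
  0≤x*y {x} {y} (inj₂ 0≈x) _ = inj₂ (sym (trans (*-congʳ (sym 0≈x)) (zeroˡ y)))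

  0<x+y : ∀ {x y} → 0# < x → 0# ≤ y → 0# < x + y
  0<x+y {x} 0<x 0≤y = <-≤-trans 0<x (≤-+ 0≤y refl)

  *-monoˡ-≤ : ∀ {x y z} → 0# ≤ z → x ≤ y → z * x ≤ z * y
  *-monoˡ-≤ {x} {y} {z} 0≤z x≤y = ≤-+ (0≤x*y 0≤z (x≤y⇒0≤y-x x≤y))
    (solve 3 (λ x y z → z :* y := z :* x :+ z :* (y :+ :- x)) refl x y z)

  *-cancelˡ-< : ∀ {x y z} → 0# ≤ z → z * x < z * y → x < y
  *-cancelˡ-< {x} {y} {z} 0≤z zx<zy with compare x y
  ... | tri< x<y _ _ = x<y
  ... | tri≈ _ x≈y _ = ⊥-elim (<-irrefl (*-congˡ x≈y) zx<zy)
  ... | tri> _ _ y<x = ⊥-elim (≤⇒≯ (*-monoˡ-≤ 0≤z (inj₁ y<x)) zx<zy)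

  ≉⇒0<² : ∀ {x} → ¬ x ≈ 0# → 0# < x * x
  ≉⇒0<² {x} x≉0 with compare x 0#
  ... | tri< x<0 _ _ = <-≤-trans (*-pos (neg-pos x<0) (neg-pos x<0)) (inj₂ (square-neg x))
  ... | tri≈ _ x≈0 _ = ⊥-elim (x≉0 x≈0)
  ... | tri> _ _ 0<x = *-pos 0<x 0<x

  -- Trichotomy decides whether `x` vanishes.
  ≉0-stable : ∀ {x} → ¬ ¬ x ≈ 0# → x ≈ 0#
  ≉0-stable {x} ¬x≉0 with compare x 0#
  ... | tri< _ x≉0 _ = ⊥-elim (¬x≉0 x≉0)
  ... | tri≈ _ x≈0 _ = x≈0
  ... | tri> _ x≉0 _ = ⊥-elim (¬x≉0 x≉0)

  *-⁻¹ : ∀ {x} → ¬ x ≈ 0# → x * x ⁻¹ ≈ 1#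
  *-⁻¹ {x} x≉0 with compare x 0#
  ... | tri< _ x≉0′ _ = proj₂ (inverse x x≉0′)
  ... | tri≈ _ x≈0 _  = ⊥-elim (x≉0 x≈0)
  ... | tri> _ x≉0′ _ = proj₂ (inverse x x≉0′)

  *-cancelʳ : ∀ {x y z} → ¬ z ≈ 0# → x * z ≈ y * z → x ≈ y
  *-cancelʳ {x} {y} {z} z≉0 xz≈yz = begin-equality
    x               ≈⟨ *-identityʳ x ⟨
    x * 1#          ≈⟨ *-congˡ (*-⁻¹ z≉0) ⟨
    x * (z * z ⁻¹)  ≈⟨ *-assoc x z _ ⟨
    x * z * z ⁻¹    ≈⟨ *-congʳ xz≈yz ⟩
    y * z * z ⁻¹    ≈⟨ *-assoc y z _ ⟩
    y * (z * z ⁻¹)  ≈⟨ *-congˡ (*-⁻¹ z≉0) ⟩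
    y * 1#          ≈⟨ *-identityʳ y ⟩
    y               ∎

  *-nonZero : ∀ {x y} → ¬ x ≈ 0# → ¬ y ≈ 0# → ¬ x * y ≈ 0#
  *-nonZero x≉0 y≉0 xy≈0 = x≉0 (*-cancelʳ y≉0 (trans xy≈0 (sym (zeroˡ _))))

  x-y≈0⇒x≈y : ∀ {x y} → x - y ≈ 0# → x ≈ y
  x-y≈0⇒x≈y {x} {y} x-y≈0 = trans (sym (x-y+y≈x x y)) (trans (+-congʳ x-y≈0) (+-identityˡ y))

  0≤fromℕ : ∀ n → 0# ≤ fromℕ n
  0≤fromℕ zero    = inj₂ refl
  0≤fromℕ (suc n) = 0≤x+y (inj₁ 0<1) (0≤fromℕ n)

  0<fromℕ-suc : ∀ n → 0# < fromℕ (suc n)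
  0<fromℕ-suc n = 0<x+y 0<1 (0≤fromℕ n)

  0≤2 : 0# ≤ 1# + 1#
  0≤2 = 0≤x+y (inj₁ 0<1) (inj₁ 0<1)

  -- The embeddings of ℤ and ℚ

  fromℤ≡ι : ∀ i → fromℤ i ≡ ι i
  fromℤ≡ι (+ n)    = ≡.refl
  fromℤ≡ι -[1+ n ] = ≡.refl

  fromℤ-homomorphism : ℤ.+-*-rawRing -Raw-AlmostCommutative⟶ fromCommutativeRing commutativeRing
  fromℤ-homomorphism = record
    { ⟦_⟧    = fromℤ
    ; +-homo = fromℤ-+
    ; *-homo = fromℤ-*
    ; -‿homo = fromℤ-neg
    ; 0-homo = refl
    ; 1-homo = +-identityʳ 1#
    }
    where
    fromℤ-+ : ∀ i j → fromℤ (i ℤ.+ j) ≈ fromℤ i + fromℤ j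
    fromℤ-+ i j rewrite fromℤ≡ι i | fromℤ≡ι j | fromℤ≡ι (i ℤ.+ j) = ι-+ i j
    fromℤ-* : ∀ i j → fromℤ (i ℤ.* j) ≈ fromℤ i * fromℤ j
    fromℤ-* i j rewrite fromℤ≡ι i | fromℤ≡ι j | fromℤ≡ι (i ℤ.* j) = ι-* i j
    fromℤ-neg : ∀ i → fromℤ (ℤ.- i) ≈ - fromℤ i
    fromℤ-neg i rewrite fromℤ≡ι i | fromℤ≡ι (ℤ.- i) = ι-neg i

  private module ℤ→ℝ = _-Raw-AlmostCommutative⟶_ fromℤ-homomorphism

  -- Cross-multiplied and stated for unnormalised fractions, so that sums and products are formed
  -- without dividing or reducing to lowest terms.
  IsFraction : Carrier → ℚᵘ → Set
  IsFraction x q = x * fromℤ (ℚᵘ.↧ q) ≈ fromℤ (ℚᵘ.↥ q)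

  fromℤ-↧≉0 : ∀ q → ¬ fromℤ (ℚᵘ.↧ q) ≈ 0#
  fromℤ-↧≉0 (mkℚᵘ _ d) ↧q≈0 = <-irrefl (sym ↧q≈0) (0<fromℕ-suc d)

  -- Both sides are multiplied by the nonzero product of the denominators. The operations on ℚ
  -- normalise their results, so they agree with those on ℚᵘ only up to `≃`; this lemma bridges the
  -- gap.
  isFraction-unique : ∀ {x y p q} → p ℚᵘ.≃ q → IsFraction x p → IsFraction y q → x ≈ y
  isFraction-unique {x} {y} {p} {q} (*≡* eq) x*↧p y*↧q =
    *-cancelʳ (*-nonZero (fromℤ-↧≉0 p) (fromℤ-↧≉0 q)) (begin-equality
      x * (↧p * ↧q)  ≈⟨ *-assoc x ↧p ↧q ⟨
      x * ↧p * ↧q    ≈⟨ *-congʳ x*↧p ⟩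
      fromℤ (ℚᵘ.↥ p) * ↧q    ≈⟨ ℤ→ℝ.*-homo (ℚᵘ.↥ p) (ℚᵘ.↧ q) ⟨
      fromℤ (ℚᵘ.↥ p ℤ.* ℚᵘ.↧ q)  ≡⟨ ≡.cong fromℤ eq ⟩
      fromℤ (ℚᵘ.↥ q ℤ.* ℚᵘ.↧ p)  ≈⟨ ℤ→ℝ.*-homo (ℚᵘ.↥ q) (ℚᵘ.↧ p) ⟩
      fromℤ (ℚᵘ.↥ q) * ↧p    ≈⟨ *-congʳ y*↧q ⟨
      y * ↧q * ↧p    ≈⟨ *-assoc y ↧q ↧p ⟩
      y * (↧q * ↧p)  ≈⟨ *-congˡ (*-comm ↧q ↧p) ⟩
      y * (↧p * ↧q)  ∎)
    where
    ↧p = fromℤ (ℚᵘ.↧ p)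
    ↧q = fromℤ (ℚᵘ.↧ q)

  isFraction-+ : ∀ {x y} p q → IsFraction x p → IsFraction y q → IsFraction (x + y) (p ℚᵘ.+ q)
  isFraction-+ {x} {y} p@(mkℚᵘ _ _) q@(mkℚᵘ _ _) x*↧p y*↧q = begin-equality
    (x + y) * fromℤ (ℚᵘ.↧ p ℤ.* ℚᵘ.↧ q)  ≈⟨ *-congˡ (ℤ→ℝ.*-homo (ℚᵘ.↧ p) (ℚᵘ.↧ q)) ⟩
    (x + y) * (↧p * ↧q)
      ≈⟨ solve 4 (λ x y m n → (x :+ y) :* (m :* n) := (x :* m) :* n :+ (y :* n) :* m)
           refl x y ↧p ↧q ⟩
    x * ↧p * ↧q + y * ↧q * ↧p  ≈⟨ +-cong (*-congʳ x*↧p) (*-congʳ y*↧q) ⟩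
    fromℤ (ℚᵘ.↥ p) * ↧q + fromℤ (ℚᵘ.↥ q) * ↧p
      ≈⟨ +-cong (ℤ→ℝ.*-homo (ℚᵘ.↥ p) (ℚᵘ.↧ q)) (ℤ→ℝ.*-homo (ℚᵘ.↥ q) (ℚᵘ.↧ p)) ⟨
    fromℤ (ℚᵘ.↥ p ℤ.* ℚᵘ.↧ q) + fromℤ (ℚᵘ.↥ q ℤ.* ℚᵘ.↧ p)
      ≈⟨ ℤ→ℝ.+-homo (ℚᵘ.↥ p ℤ.* ℚᵘ.↧ q) (ℚᵘ.↥ q ℤ.* ℚᵘ.↧ p) ⟨
    fromℤ (ℚᵘ.↥ (p ℚᵘ.+ q))  ∎
    where
    ↧p = fromℤ (ℚᵘ.↧ p)
    ↧q = fromℤ (ℚᵘ.↧ q)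

  isFraction-* : ∀ {x y} p q → IsFraction x p → IsFraction y q → IsFraction (x * y) (p ℚᵘ.* q)
  isFraction-* {x} {y} p@(mkℚᵘ _ _) q@(mkℚᵘ _ _) x*↧p y*↧q = begin-equality
    (x * y) * fromℤ (ℚᵘ.↧ p ℤ.* ℚᵘ.↧ q)  ≈⟨ *-congˡ (ℤ→ℝ.*-homo (ℚᵘ.↧ p) (ℚᵘ.↧ q)) ⟩
    (x * y) * (↧p * ↧q)
      ≈⟨ solve 4 (λ x y m n → (x :* y) :* (m :* n) := (x :* m) :* (y :* n))
           refl x y ↧p ↧q ⟩
    (x * ↧p) * (y * ↧q)  ≈⟨ *-cong x*↧p y*↧q ⟩
    fromℤ (ℚᵘ.↥ p) * fromℤ (ℚᵘ.↥ q)  ≈⟨ ℤ→ℝ.*-homo (ℚᵘ.↥ p) (ℚᵘ.↥ q) ⟨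
    fromℤ (ℚᵘ.↥ p ℤ.* ℚᵘ.↥ q)  ∎
    where
    ↧p = fromℤ (ℚᵘ.↧ p)
    ↧q = fromℤ (ℚᵘ.↧ q)

  isFraction-neg : ∀ {x} p → IsFraction x p → IsFraction (- x) (ℚᵘ.- p)
  isFraction-neg {x} p@(mkℚᵘ n _) x*↧p = begin-equality
    - x * fromℤ (ℚᵘ.↧ p)    ≈⟨ -‿distribˡ-* x _ ⟨
    - (x * fromℤ (ℚᵘ.↧ p))  ≈⟨ -‿cong x*↧p ⟩
    - fromℤ n               ≈⟨ ℤ→ℝ.-‿homo n ⟨
    fromℤ (ℤ.- n)           ∎

  fromℚ-isFraction : ∀ q → IsFraction (fromℚ q) (toℚᵘ q)
  fromℚ-isFraction q@(mkℚ n d _) = begin-equality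
    fromℤ n * fromℤ (+ suc d) ⁻¹ * fromℤ (+ suc d)
      ≈⟨ solve 3 (λ x y z → x :* y :* z := x :* (z :* y)) refl (fromℤ n) _ (fromℤ (+ suc d)) ⟩
    fromℤ n * (fromℤ (+ suc d) * fromℤ (+ suc d) ⁻¹)
      ≈⟨ *-congˡ (*-⁻¹ (fromℤ-↧≉0 (mkℚᵘ n d))) ⟩
    fromℤ n * 1#   ≈⟨ *-identityʳ _ ⟩
    fromℤ n        ∎

  fromℚ-homomorphism : ℚ.+-*-rawRing -Raw-AlmostCommutative⟶ fromCommutativeRing commutativeRing
  fromℚ-homomorphism = record
    { ⟦_⟧    = fromℚ
    ; +-homo = λ p q → isFraction-unique (ℚ.toℚᵘ-homo-+ p q) (fromℚ-isFraction (p ℚ.+ q))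
                 (isFraction-+ (toℚᵘ p) (toℚᵘ q) (fromℚ-isFraction p) (fromℚ-isFraction q))
    ; *-homo = λ p q → isFraction-unique (ℚ.toℚᵘ-homo-* p q) (fromℚ-isFraction (p ℚ.* q))
                 (isFraction-* (toℚᵘ p) (toℚᵘ q) (fromℚ-isFraction p) (fromℚ-isFraction q))
    ; -‿homo = λ p → isFraction-unique (ℚ.toℚᵘ-homo‿- p) (fromℚ-isFraction (ℚ.- p))
                 (isFraction-neg (toℚᵘ p) (fromℚ-isFraction p))
    ; 0-homo = zeroˡ _
    ; 1-homo = *-⁻¹ (fromℤ-↧≉0 ℚᵘ.1ℚᵘ)
    }

  -- The argument `0` is the predecessor of the denominator `1`. Numerator and denominator are then
  -- available by computation.
  integer : ℤ → ℚ
  integer i = mkℚ i 0 (Coprimality.sym (Coprimality.1-coprimeTo ℤ.∣ i ∣))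

  fromℚ-integer : ∀ i → fromℚ (integer i) ≈ fromℤ i
  fromℚ-integer i = isFraction-unique {p = mkℚᵘ i 0} {mkℚᵘ i 0} (*≡* ≡.refl) (fromℚ-isFraction (integer i))
    (trans (*-congˡ (+-identityʳ 1#)) (*-identityʳ _))

-- The complex numbers as a commutative ring

module ComplexRing (ℝ : CompleteOrderedField) where
  open CompleteOrderedField ℝ
  open ComplexNumbers ℝ
  open IntegerCoefficients commutativeRing

  abstract
    ℂ-isCommutativeRing : IsCommutativeRing ℂ._≈_ ℂ._+_ ℂ._*_ ℂ.-_ ℂ.0# ℂ.1#
    ℂ-isCommutativeRing = record
      { isRing = record
        { +-isAbelianGroup = record
          { isGroup = record
            { isMonoid = record
              { isSemigroup = record
                { isMagma = record
                  { isEquivalence = record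
                    { refl = refl , refl
                    ; sym = λ (p , q) → sym p , sym q
                    ; trans = λ (p , q) (p′ , q′) → trans p p′ , trans q q′
                    }
                  ; ∙-cong = λ (p , q) (p′ , q′) → +-cong p p′ , +-cong q q′
                  }
                ; assoc = λ _ _ _ → +-assoc _ _ _ , +-assoc _ _ _
                }
              ; identity = (λ _ → +-identityˡ _ , +-identityˡ _)
                         , (λ _ → +-identityʳ _ , +-identityʳ _)
              }
            ; inverse = (λ _ → -‿inverseˡ _ , -‿inverseˡ _)
                      , (λ _ → -‿inverseʳ _ , -‿inverseʳ _)
            ; ⁻¹-cong = λ (p , q) → -‿cong p , -‿cong q
            }
          ; comm = λ _ _ → +-comm _ _ , +-comm _ _
          }
        ; *-cong = λ (p , q) (p′ , q′) →
            +-cong (*-cong p p′) (-‿cong (*-cong q q′)) , +-cong (*-cong p q′) (*-cong q p′)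
        ; *-assoc = λ (a , b) (c , d) (e , f) →
            solve 6 (λ a b c d e f →
              (a :* c :+ :- (b :* d)) :* e :+ :- ((a :* d :+ b :* c) :* f) :=
              a :* (c :* e :+ :- (d :* f)) :+ :- (b :* (c :* f :+ d :* e))) refl a b c d e f ,
            solve 6 (λ a b c d e f →
              (a :* c :+ :- (b :* d)) :* f :+ (a :* d :+ b :* c) :* e :=
              a :* (c :* f :+ d :* e) :+ b :* (c :* e :+ :- (d :* f))) refl a b c d e f
        ; *-identity =
            (λ (a , b) →
              solve 2 (λ a b → con (+ 1) :* a :+ :- (con (+ 0) :* b) := a) refl a b ,
              solve 2 (λ a b → con (+ 1) :* b :+ con (+ 0) :* a := b) refl a b) ,
            (λ (a , b) →
              solve 2 (λ a b → a :* con (+ 1) :+ :- (b :* con (+ 0)) := a) refl a b ,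
              solve 2 (λ a b → a :* con (+ 0) :+ b :* con (+ 1) := b) refl a b)
        ; distrib =
            (λ (a , b) (c , d) (e , f) →
              solve 6 (λ a b c d e f →
                a :* (c :+ e) :+ :- (b :* (d :+ f)) :=
                (a :* c :+ :- (b :* d)) :+ (a :* e :+ :- (b :* f))) refl a b c d e f ,
              solve 6 (λ a b c d e f →
                a :* (d :+ f) :+ b :* (c :+ e) :=
                (a :* d :+ b :* c) :+ (a :* f :+ b :* e)) refl a b c d e f) ,
            (λ (a , b) (c , d) (e , f) →
              solve 6 (λ a b c d e f →
                (c :+ e) :* a :+ :- ((d :+ f) :* b) :=
                (c :* a :+ :- (d :* b)) :+ (e :* a :+ :- (f :* b))) refl a b c d e f ,
              solve 6 (λ a b c d e f →
                (c :+ e) :* b :+ (d :+ f) :* a :=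
                (c :* b :+ d :* a) :+ (e :* b :+ f :* a)) refl a b c d e f)
        }
      ; *-comm = λ (a , b) (c , d) →
          solve 4 (λ a b c d → a :* c :+ :- (b :* d) := c :* a :+ :- (d :* b)) refl a b c d ,
          solve 4 (λ a b c d → a :* d :+ b :* c := c :* b :+ d :* a) refl a b c d
      }

  ℂ-commutativeRing : CommutativeRing 0ℓ 0ℓ
  ℂ-commutativeRing = record { RawRing ℂ ; isCommutativeRing = ℂ-isCommutativeRing }

  fromReal-homomorphism : rawRing -Raw-AlmostCommutative⟶ fromCommutativeRing ℂ-commutativeRing
  fromReal-homomorphism = record
    { ⟦_⟧    = fromReal
    ; +-homo = λ _ _ → refl , sym (+-identityʳ 0#)
    ; *-homo = λ a b → solve 2 (λ a b → a :* b := a :* b :+ :- (con (+ 0) :* con (+ 0))) refl a b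
                     , solve 2 (λ a b → con (+ 0) := a :* con (+ 0) :+ con (+ 0) :* b) refl a b
    ; -‿homo = λ _ → refl , solve 0 (con (+ 0) := :- con (+ 0)) refl
    ; 0-homo = refl , refl
    ; 1-homo = refl , refl
    }

-- Coefficient vectors modulo a monic polynomial

module Coefficients (Coeff : RawRing 0ℓ 0ℓ) where
  private module K = RawRing Coeff

  addMultiple : ∀ {n} → K.Carrier → Vec K.Carrier n → Vec K.Carrier n → Vec K.Carrier n
  addMultiple t = zipWith (λ a b → a K.+ t K.* b)

  -- The polynomial `a + X v`, split into its coefficients below degree `n` and the coefficient of
  -- degree `n` that overflows.
  shift : ∀ {n} → K.Carrier → Vec K.Carrier n → Vec K.Carrier n × K.Carrier
  shift a []      = [] , a
  shift a (b ∷ v) = let w , t = shift b v in a ∷ w , t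

  -- The coefficients of a + X v modulo the monic polynomial p.
  reduce : ∀ {n} → Vec K.Carrier n → K.Carrier → Vec K.Carrier n → Vec K.Carrier n
  reduce p a v = let w , t = shift a v in addMultiple (K.- t) w p

-- Values of polynomials at a point

module Horner (Coeff : RawRing 0ℓ 0ℓ) (R : CommutativeRing 0ℓ 0ℓ)
              (hom : Coeff -Raw-AlmostCommutative⟶ fromCommutativeRing R)
              (x : CommutativeRing.Carrier R) where
  private module K = RawRing Coeff
  open CommutativeRing R
  open Coefficients Coeff
  open _-Raw-AlmostCommutative⟶_ hom
  open Exponentiation semiring using (_^_)
  open Evaluation rawRing using (eval)
  open IntegerCoefficients R
  open SetoidReasoning setoid

  -- In contrast to `eval`, there is no implicit leading term: the degree is less than `n`.
  horner : ∀ {n} → Vec K.Carrier n → Carrier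
  horner []      = 0#
  horner (a ∷ v) = ⟦ a ⟧ + x * horner v

  eval≈horner : ∀ {n} (p : Vec K.Carrier n) → eval ⟦_⟧ p x ≈ horner p + x ^ n
  eval≈horner []              = sym (+-identityˡ 1#)
  eval≈horner {suc n} (a ∷ p) = begin
    ⟦ a ⟧ + x * eval ⟦_⟧ p x             ≈⟨ +-congˡ (*-congˡ (eval≈horner p)) ⟩
    ⟦ a ⟧ + x * (horner p + x ^ n)
      ≈⟨ solve 4 (λ a x h y → a :+ x :* (h :+ y) := (a :+ x :* h) :+ x :* y)
           refl ⟦ a ⟧ x (horner p) (x ^ n) ⟩
    (⟦ a ⟧ + x * horner p) + x * x ^ n   ∎

  horner-addMultiple : ∀ {n} t (v w : Vec K.Carrier n) →
                       horner (addMultiple t v w) ≈ horner v + ⟦ t ⟧ * horner w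
  horner-addMultiple t []      []      = solve 1 (λ t → con (+ 0) := con (+ 0) :+ t :* con (+ 0)) refl ⟦ t ⟧
  horner-addMultiple t (a ∷ v) (b ∷ w) = begin
    ⟦ a K.+ t K.* b ⟧ + x * horner (addMultiple t v w)
      ≈⟨ +-cong (trans (+-homo a (t K.* b)) (+-congˡ (*-homo t b))) (*-congˡ (horner-addMultiple t v w)) ⟩
    (⟦ a ⟧ + ⟦ t ⟧ * ⟦ b ⟧) + x * (horner v + ⟦ t ⟧ * horner w)
      ≈⟨ solve 6 (λ a t b x v w → (a :+ t :* b) :+ x :* (v :+ t :* w) := (a :+ x :* v) :+ t :* (b :+ x :* w))
           refl ⟦ a ⟧ ⟦ t ⟧ ⟦ b ⟧ x (horner v) (horner w) ⟩
    (⟦ a ⟧ + x * horner v) + ⟦ t ⟧ * (⟦ b ⟧ + x * horner w) ∎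

  horner-zero : ∀ n → horner (replicate n K.0#) ≈ 0#
  horner-zero zero    = refl
  horner-zero (suc n) = begin
    ⟦ K.0# ⟧ + x * horner (replicate n K.0#)  ≈⟨ +-cong 0-homo (*-congˡ (horner-zero n)) ⟩
    0# + x * 0#                               ≈⟨ trans (+-identityˡ _) (zeroʳ x) ⟩
    0#                                        ∎

  horner-padRight : ∀ {m n} (m≤n : m ℕ.≤ n) (v : Vec K.Carrier m) →
                    horner (padRight m≤n K.0# v) ≈ horner v
  horner-padRight {n = n} z≤n [] = horner-zero n
  horner-padRight (s≤s m≤n) (a ∷ v) = +-congˡ (*-congˡ (horner-padRight m≤n v))

  horner-shift : ∀ {n} a (v : Vec K.Carrier n) → let w , t = shift a v in
                 horner w + ⟦ t ⟧ * x ^ n ≈ ⟦ a ⟧ + x * horner v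
  horner-shift a [] = solve 2 (λ a x → con (+ 0) :+ a :* con (+ 1) := a :+ x :* con (+ 0)) refl ⟦ a ⟧ x
  horner-shift {suc n} a (b ∷ v) = let w , t = shift b v in begin
    (⟦ a ⟧ + x * horner w) + ⟦ t ⟧ * (x * x ^ n)
      ≈⟨ solve 5 (λ a x w t y → (a :+ x :* w) :+ t :* (x :* y) := a :+ x :* (w :+ t :* y))
           refl ⟦ a ⟧ x (horner w) ⟦ t ⟧ (x ^ n) ⟩
    ⟦ a ⟧ + x * (horner w + ⟦ t ⟧ * x ^ n)  ≈⟨ +-congˡ (*-congˡ (horner-shift b v)) ⟩
    ⟦ a ⟧ + x * (⟦ b ⟧ + x * horner v)      ∎

  -- Membership in the span of `1`, `x`, ..., `xⁿ⁻¹` over the coefficients; the degree stays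
  -- strictly below `n`.
  IsValue : ℕ → Carrier → Set
  IsValue n u = Σ[ v ∈ Vec K.Carrier n ] u ≈ horner v

  isValue-resp : ∀ {n u w} → u ≈ w → IsValue n u → IsValue n w
  isValue-resp u≈w (v , u≈v) = v , trans (sym u≈w) u≈v

  isValue-addMultiple : ∀ {n u w} t → IsValue n u → IsValue n w → IsValue n (u + ⟦ t ⟧ * w)
  isValue-addMultiple t (v , u≈v) (v′ , w≈v′) =
    addMultiple t v v′ , trans (+-cong u≈v (*-congˡ w≈v′)) (sym (horner-addMultiple t v v′))

  isValue-zero : ∀ n → IsValue n 0#
  isValue-zero n = replicate n K.0# , sym (horner-zero n)

  isValue-cons : ∀ {n u} a → IsValue n u → IsValue (suc n) (⟦ a ⟧ + x * u)
  isValue-cons a (v , u≈v) = a ∷ v , +-congˡ (*-congˡ u≈v)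

  isValue-addConstant : ∀ {n u} a → IsValue (suc n) u → IsValue (suc n) (⟦ a ⟧ + u)
  isValue-addConstant a (b ∷ v , u≈v) = (a K.+ b) ∷ v ,
    trans (+-congˡ u≈v) (trans (sym (+-assoc _ _ _)) (+-congʳ (sym (+-homo a b))))

  isValue-mono : ∀ {m n u} → m ℕ.≤ n → IsValue m u → IsValue n u
  isValue-mono m≤n (v , u≈v) = padRight m≤n K.0# v , trans u≈v (sym (horner-padRight m≤n v))

  isValue-^ : ∀ n → IsValue (suc n) (x ^ n)
  isValue-^ zero    = K.1# ∷ [] ,
    trans (solve 1 (λ x → con (+ 1) := con (+ 1) :+ x :* con (+ 0)) refl x) (+-congʳ (sym 1-homo))
  isValue-^ (suc n) = isValue-resp (trans (+-congʳ 0-homo) (+-identityˡ _)) (isValue-cons K.0# (isValue-^ n))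

  -- Subtracting `t` times the monic polynomial `p` removes the overflow `t xⁿ`, and it leaves the
  -- value unchanged because `x` is a root of `p`.
  horner-reduce : ∀ {n} {p : Vec K.Carrier n} → eval ⟦_⟧ p x ≈ 0# → ∀ a v →
                  horner (reduce p a v) ≈ ⟦ a ⟧ + x * horner v
  horner-reduce {n} {p} px≈0 a v = let w , t = shift a v in begin
    horner (addMultiple (K.- t) w p)   ≈⟨ horner-addMultiple (K.- t) w p ⟩
    horner w + ⟦ K.- t ⟧ * horner p    ≈⟨ +-congˡ (*-congʳ (-‿homo t)) ⟩
    horner w + - ⟦ t ⟧ * horner p
      ≈⟨ solve 4 (λ w t p y → w :+ :- t :* p := (w :+ t :* y) :+ :- t :* (p :+ y))
           refl (horner w) ⟦ t ⟧ (horner p) (x ^ n) ⟩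
    (horner w + ⟦ t ⟧ * x ^ n) + - ⟦ t ⟧ * (horner p + x ^ n)
      ≈⟨ +-cong (horner-shift a v) (*-congˡ (trans (sym (eval≈horner p)) px≈0)) ⟩
    (⟦ a ⟧ + x * horner v) + - ⟦ t ⟧ * 0#
      ≈⟨ trans (+-congˡ (zeroʳ _)) (+-identityʳ _) ⟩
    ⟦ a ⟧ + x * horner v               ∎

-- The embedding of ℚ(β) into ℂ determined by a conjugate

module Conjugation (ℝ : CompleteOrderedField) where
  open CompleteOrderedField ℝ
  open OrderedField ℝ
  open ComplexNumbers ℝ
  open ComplexRing ℝ
  open AlgebraicNumbers ℝ
  private
    module ℚ→ℝ = _-Raw-AlmostCommutative⟶_ fromℚ-homomorphism
    module r = _-Raw-AlmostCommutative⟶_ fromReal-homomorphism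
    module ℂᶜ = CommutativeRing ℂ-commutativeRing

  fromℚ-complex-homomorphism : ℚ.+-*-rawRing -Raw-AlmostCommutative⟶ fromCommutativeRing ℂ-commutativeRing
  fromℚ-complex-homomorphism = record
    { ⟦_⟧    = fromReal ∘ fromℚ
    ; +-homo = λ p q → ℂᶜ.trans (ℚ→ℝ.+-homo p q , refl) (r.+-homo (fromℚ p) (fromℚ q))
    ; *-homo = λ p q → ℂᶜ.trans (ℚ→ℝ.*-homo p q , refl) (r.*-homo (fromℚ p) (fromℚ q))
    ; -‿homo = λ p → ℂᶜ.trans (ℚ→ℝ.-‿homo p , refl) (r.-‿homo (fromℚ p))
    ; 0-homo = ℚ→ℝ.0-homo , refl
    ; 1-homo = ℚ→ℝ.1-homo , refl
    }

  module _ (β : Carrier) where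
    open Horner ℚ.+-*-rawRing commutativeRing fromℚ-homomorphism β
    open Evaluation rawRing using (eval)
    open SetoidReasoning setoid

    -- Splits off the leading coefficient `c`, because minimality of a polynomial is stated against
    -- monic competitors.
    ScaledMonic : ∀ {m} → Vec ℚ m → Set
    ScaledMonic {m} v = ∃ λ k → k ℕ.< m × Σ[ q ∈ Monic ℚ k ] ∃ λ c → c ≢ 0ℚ ×
      horner v ≈ fromℚ c * eval fromℚ q β

    -- The higher coefficients are examined first. If they are not all zero, their leading
    -- coefficient `c` stays the leading one and `a` becomes the constant term `a / c`; otherwise
    -- `a` is itself zero or the leading coefficient.
    zero-or-scaledMonic : ∀ {m} (v : Vec ℚ m) → v ≡ replicate m 0ℚ ⊎ ScaledMonic v
    zero-or-scaledMonic [] = inj₁ ≡.refl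
    zero-or-scaledMonic {suc m} (a ∷ v) with zero-or-scaledMonic v
    ... | inj₂ (k , k<m , q , c , c≢0 , v≈cq) =
      inj₂ (suc k , s≤s k<m , (ℚ.1/ c) ℚ.* a ∷ q , c , c≢0 , (begin
        fromℚ a + β * horner v
          ≈⟨ +-cong (reflexive (≡.cong fromℚ (≡.sym c*[1/c*a]≡a))) (*-congˡ v≈cq) ⟩
        fromℚ (c ℚ.* (ℚ.1/ c ℚ.* a)) + β * (fromℚ c * eval fromℚ q β)
          ≈⟨ +-congʳ (ℚ→ℝ.*-homo c _) ⟩
        fromℚ c * fromℚ (ℚ.1/ c ℚ.* a) + β * (fromℚ c * eval fromℚ q β)
          ≈⟨ solve 4 (λ c b x q → c :* b :+ x :* (c :* q) := c :* (b :+ x :* q))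
               refl (fromℚ c) (fromℚ (ℚ.1/ c ℚ.* a)) β (eval fromℚ q β) ⟩
        fromℚ c * (fromℚ (ℚ.1/ c ℚ.* a) + β * eval fromℚ q β) ∎))
      where
      open IntegerCoefficients commutativeRing
      instance _ = ℚ.≢-nonZero c≢0
      c*[1/c*a]≡a : c ℚ.* (ℚ.1/ c ℚ.* a) ≡ a
      c*[1/c*a]≡a = ≡.trans (≡.sym (ℚ.*-assoc c (ℚ.1/ c) a))
        (≡.trans (≡.cong (ℚ._* a) (ℚ.*-inverseʳ c)) (ℚ.*-identityˡ a))
    ... | inj₁ v≡0 with a ℚ.≟ 0ℚ
    ...   | yes a≡0 = inj₁ (≡.cong₂ _∷_ a≡0 v≡0)
    ...   | no  a≢0 = inj₂ (0 , s≤s z≤n , [] , a , a≢0 , (begin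
      fromℚ a + β * horner v                  ≡⟨ ≡.cong (λ w → fromℚ a + β * horner w) v≡0 ⟩
      fromℚ a + β * horner (replicate m 0ℚ)   ≈⟨ +-congˡ (*-congˡ (horner-zero m)) ⟩
      fromℚ a + β * 0#                        ≈⟨ trans (+-congˡ (zeroʳ β)) (+-identityʳ _) ⟩
      fromℚ a                                 ≈⟨ *-identityʳ _ ⟨
      fromℚ a * 1#                            ∎))

    fromℚ-≉0 : ∀ {c} → c ≢ 0ℚ → ¬ fromℚ c ≈ 0#
    fromℚ-≉0 {c} c≢0 c≈0 = 1≉0 (begin
      1#                             ≈⟨ ℚ→ℝ.1-homo ⟨
      fromℚ 1ℚ                       ≡⟨ ≡.cong fromℚ (ℚ.*-inverseʳ c) ⟨
      fromℚ (c ℚ.* ℚ.1/ c)           ≈⟨ ℚ→ℝ.*-homo c (ℚ.1/ c) ⟩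
      fromℚ c * fromℚ (ℚ.1/ c)       ≈⟨ *-congʳ c≈0 ⟩
      0# * fromℚ (ℚ.1/ c)            ≈⟨ zeroˡ _ ⟩
      0#                             ∎)
      where instance _ = ℚ.≢-nonZero c≢0

    -- A nonzero `v` divided by its leading coefficient would be a monic polynomial of degree below
    -- `n` with root `β`. Hence coordinates with respect to the powers of `β` are unique.
    minimal⇒horner-injective : ∀ {n} {p : Monic ℚ n} → IsMinimalPolynomial p β →
                               ∀ (v : Vec ℚ n) → horner v ≈ 0# → v ≡ replicate n 0ℚ
    minimal⇒horner-injective (_ , minimal) v v≈0 with zero-or-scaledMonic v
    ... | inj₁ v≡0 = v≡0
    ... | inj₂ (k , k<n , q , c , c≢0 , v≈cq) = ⊥-elim (ℕ.<⇒≱ k<n (minimal q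
      (*-cancelʳ (fromℚ-≉0 c≢0) (trans (*-comm _ _) (trans (sym v≈cq) (trans v≈0 (sym (zeroˡ _))))))))

  open Coefficients ℚ.+-*-rawRing

  module _ {β : Carrier} {γ : ℂ.Carrier} {n} (p : Monic ℚ n) (pβ : IsMinimalPolynomial p β)
           (pγ≈0 : Evaluation.eval ℂ (fromReal ∘ fromℚ) p γ ℂ.≈ ℂ.0#) where
    private
      module Hβ = Horner ℚ.+-*-rawRing commutativeRing fromℚ-homomorphism β
      module Hγ = Horner ℚ.+-*-rawRing ℂ-commutativeRing fromℚ-complex-homomorphism γ

    -- The graph of the embedding ℚ(β) → ℂ that sends β to γ.
    Conjugates : Carrier → ℂ.Carrier → Set
    Conjugates u z = Σ[ v ∈ Vec ℚ n ] (u ≈ Hβ.horner v × z ℂ.≈ Hγ.horner v)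

    conjugates-resp : ∀ {u u′ z z′} → u ≈ u′ → z ℂ.≈ z′ → Conjugates u z → Conjugates u′ z′
    conjugates-resp u≈u′ z≈z′ (v , u≈v , z≈v) = v , trans (sym u≈u′) u≈v , ℂᶜ.trans (ℂᶜ.sym z≈z′) z≈v

    conjugates-zero : Conjugates 0# ℂ.0#
    conjugates-zero = replicate n 0ℚ , sym (Hβ.horner-zero n) , ℂᶜ.sym (Hγ.horner-zero n)

    conjugates-addMultiple : ∀ {u u′ z z′} t → Conjugates u z → Conjugates u′ z′ →
      Conjugates (u + fromℚ t * u′) (z ℂ.+ fromReal (fromℚ t) ℂ.* z′)
    conjugates-addMultiple t (v , u≈v , z≈v) (w , u′≈w , z′≈w) = addMultiple t v w ,
      trans (+-cong u≈v (*-congˡ u′≈w)) (sym (Hβ.horner-addMultiple t v w)) ,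
      ℂᶜ.trans (ℂᶜ.+-cong z≈v (ℂᶜ.*-congˡ {fromReal (fromℚ t)} z′≈w)) (ℂᶜ.sym (Hγ.horner-addMultiple t v w))

    -- One and the same reduction modulo `p` is valid at `β` and at `γ`, since both are roots of
    -- `p`. So multiplication by `β` corresponds to multiplication by `γ`.
    conjugates-cons : ∀ {u z} a → Conjugates u z →
      Conjugates (fromℚ a + β * u) (fromReal (fromℚ a) ℂ.+ γ ℂ.* z)
    conjugates-cons a (v , u≈v , z≈v) = reduce p a v ,
      trans (+-congˡ (*-congˡ u≈v)) (sym (Hβ.horner-reduce (proj₁ pβ) a v)) ,
      ℂᶜ.trans (ℂᶜ.+-congˡ {fromReal (fromℚ a)} (ℂᶜ.*-congˡ {γ} z≈v)) (ℂᶜ.sym (Hγ.horner-reduce pγ≈0 a v))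

    private
      -1≈ : fromℚ (integer (ℤ.- + 1)) ≈ - 1#
      -1≈ = trans (fromℚ-integer (ℤ.- + 1)) (-‿cong (+-identityʳ 1#))

    conjugates-minus : ∀ {u u′ z z′} → Conjugates u z → Conjugates u′ z′ →
      Conjugates (u + - u′) (z ℂ.+ ℂ.- z′)
    conjugates-minus {u} {u′} {z} {z′} c c′ = conjugates-resp
      (+-congˡ (trans (*-congʳ -1≈) (RingProperties.-1*x≈-x ring u′)))
      (ℂᶜ.+-congˡ {z} (ℂᶜ.trans (ℂᶜ.*-congʳ {z′} (-1≈ , sym (RingProperties.-0#≈0# ring)))
        (RingProperties.-1*x≈-x ℂᶜ.ring z′)))
      (conjugates-addMultiple (integer (ℤ.- + 1)) c c′)

    -- The coefficient vector must be zero by injectivity at `β`, so its value at `γ` is zero too.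
    -- Applied to differences, this says that the conjugate is well defined.
    conjugates-of-zero : ∀ {u z} → Conjugates u z → u ≈ 0# → z ℂ.≈ ℂ.0#
    conjugates-of-zero (v , u≈v , z≈v) u≈0
      with ≡.refl ← minimal⇒horner-injective β {p = p} pβ v (trans (sym u≈v) u≈0) =
      ℂᶜ.trans z≈v (Hγ.horner-zero n)

-- The Archimedean property and geometric growth

module Growth (em : ExcludedMiddle 0ℓ) (ℝ : CompleteOrderedField) where
  open CompleteOrderedField ℝ
  open OrderedFieldProperties ℝ
  open OrderedField ℝ
  open Floor em ℝ
  open IntegerCoefficients commutativeRing
  open StrictReasoning (StrictTotalOrder.strictPartialOrder strictTotalOrder)

  archimedean-* : ∀ {a} → 0# < a → ∀ b → ∃ λ n → b < fromℕ n * a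
  archimedean-* {a} 0<a b = n , <-+ (*-pos (x<y⇒0<y-x (proj₂ (archimedean (b * a ⁻¹)))) 0<a) (begin-equality
    fromℕ n * a
      ≈⟨ solve 4 (λ n a b c → n :* a := b :* (a :* c) :+ (n :+ :- (b :* c)) :* a) refl (fromℕ n) a b (a ⁻¹) ⟩
    b * (a * a ⁻¹) + (fromℕ n - b * a ⁻¹) * a
      ≈⟨ +-congʳ (trans (*-congˡ (*-⁻¹ (λ a≈0 → <-irrefl (sym a≈0) 0<a))) (*-identityʳ b)) ⟩
    b + (fromℕ n - b * a ⁻¹) * a  ∎)
    where n = proj₁ (archimedean (b * a ⁻¹))

  -- Bernoulli's inequality `(1 + e)ᵏ ≥ 1 + k e`, scaled by `s 0`. In the induction step the slack
  -- is that of the hypothesis plus `e` times the nonnegative `s k - s 0`.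
  bernoulli : ∀ {e} {s : ℕ → Carrier} → 0# ≤ e → 0# ≤ s 0 → (∀ k → s (suc k) ≈ s k + e * s k) →
              ∀ k → s 0 + fromℕ k * (e * s 0) ≤ s k
  bernoulli {e} {s} 0≤e 0≤s₀ step zero    = inj₂ (trans (+-congˡ (zeroˡ _)) (+-identityʳ _))
  bernoulli {e} {s} 0≤e 0≤s₀ step (suc k) =
    ≤-+ (0≤x+y (x≤y⇒0≤y-x ih) (0≤x*y 0≤e (x≤y⇒0≤y-x s₀≤sₖ))) (trans (step k)
      (solve 4 (λ e a n b →
         b :+ e :* b :=
         (a :+ (con (+ 1) :+ n) :* (e :* a)) :+
         ((b :+ :- (a :+ n :* (e :* a))) :+ e :* (b :+ :- a)))
       refl e (s 0) (fromℕ k) (s k)))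
    where
    ih : s 0 + fromℕ k * (e * s 0) ≤ s k
    ih = bernoulli {s = s} 0≤e 0≤s₀ step k
    s₀≤sₖ : s 0 ≤ s k
    s₀≤sₖ = ≤-trans (≤-+ (0≤x*y (0≤fromℕ k) (0≤x*y 0≤e 0≤s₀)) refl) ih

  geometric-unbounded : ∀ {e} {s : ℕ → Carrier} → 0# < e → 0# < s 0 →
                        (∀ k → s (suc k) ≈ s k + e * s k) → ∀ b → ∃ λ k → b < s k
  geometric-unbounded {e} {s} 0<e 0<s₀ step b =
    let k , b<k*es₀ = archimedean-* (*-pos 0<e 0<s₀) b in
    k , <-≤-trans b<k*es₀ (≤-trans (≤-+ (inj₁ 0<s₀) (+-comm _ _))
      (bernoulli {s = s} (inj₁ 0<e) (inj₁ 0<s₀) step k))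

-- The transformation T, its orbits and its digits

module Expansion (em : ExcludedMiddle 0ℓ) (ℝ : CompleteOrderedField)
                 (β : CompleteOrderedField.Carrier ℝ)
                 (1<β : CompleteOrderedField._<_ ℝ (CompleteOrderedField.1# ℝ) β) where
  open CompleteOrderedField ℝ
  open OrderedFieldProperties ℝ
  open OrderedField ℝ
  open Floor em ℝ
  open Growth em ℝ
  open NegativeBase em ℝ β
  open IntegerCoefficients commutativeRing
  open StrictReasoning (StrictTotalOrder.strictPartialOrder strictTotalOrder)

  0<β : 0# < β
  0<β = <-trans 0<1 1<β

  β+1≉0 : ¬ β + 1# ≈ 0#
  β+1≉0 β+1≈0 = <-irrefl (sym β+1≈0) (0<x+y 0<β (inj₁ 0<1))

  inv : Carrier
  inv = (β + 1#) ⁻¹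

  [β+1]*inv≈1 : (β + 1#) * inv ≈ 1#
  [β+1]*inv≈1 = *-⁻¹ β+1≉0

  0<inv : 0# < inv
  0<inv = begin-strict
    0#                  <⟨ *-pos (0<x+y 0<β (inj₁ 0<1)) (≉⇒0<² inv≉0) ⟩
    (β + 1#) * (inv * inv)  ≈⟨ *-assoc _ inv inv ⟨
    (β + 1#) * inv * inv    ≈⟨ *-congʳ [β+1]*inv≈1 ⟩
    1# * inv              ≈⟨ *-identityˡ inv ⟩
    inv                   ∎
    where
    inv≉0 : ¬ inv ≈ 0#
    inv≉0 inv≈0 = 1≉0 (trans (sym [β+1]*inv≈1) (trans (*-congˡ inv≈0) (zeroʳ _)))

  l+1≈r : l + 1# ≈ r
  l+1≈r = begin-equality
    - (β * inv) + 1#              ≈⟨ +-congˡ [β+1]*inv≈1 ⟨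
    - (β * inv) + (β + 1#) * inv    ≈⟨ solve 2 (λ β inv → :- (β :* inv) :+ (β :+ con (+ 1)) :* inv := con (+ 1) :* inv)
                                     refl β inv ⟩
    1# * inv                      ∎

  l*[β+1]≈-β : l * (β + 1#) ≈ - β
  l*[β+1]≈-β = begin-equality
    - (β * inv) * (β + 1#)
      ≈⟨ solve 2 (λ β inv → :- (β :* inv) :* (β :+ con (+ 1)) := :- (β :* ((β :+ con (+ 1)) :* inv)))
           refl β inv ⟩
    - (β * ((β + 1#) * inv))  ≈⟨ -‿cong (trans (*-congˡ [β+1]*inv≈1) (*-identityʳ β)) ⟩
    - β                     ∎

  l∈I : l ∈I
  l∈I = inj₂ refl , <-+ 0<1 (sym l+1≈r)

  -- The interval has length one, so each real has an integer translate in it. With `y = −βx` this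
  -- is the invariance of I under `T`; with `y = nβ` it supplies points of ℚ(β) in I.
  y-⌊y-l⌋∈I : ∀ y → (y - fromℤ ⌊ y - l ⌋) ∈I
  y-⌊y-l⌋∈I y with floor (y - l)
  ... | k , k≤y-l , y-l<k+1 =
    ≤-+ (x≤y⇒0≤y-x k≤y-l) (solve 3 (λ y k l → y :+ :- k := l :+ ((y :+ :- l) :+ :- k)) refl y (fromℤ k) l) ,
    <-+ (x<y⇒0<y-x y-l<k+1) (trans (sym l+1≈r)
      (solve 3 (λ y k l → l :+ con (+ 1) := (y :+ :- k) :+ ((k :+ con (+ 1)) :+ :- (y :+ :- l)))
         refl y (fromℤ k) l))

  orbit : Carrier → ℕ → Carrier
  orbit x = fold x T

  orbit-∈I : ∀ {x} → x ∈I → ∀ k → orbit x k ∈I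
  orbit-∈I x∈I zero        = x∈I
  orbit-∈I {x} x∈I (suc k) = y-⌊y-l⌋∈I (- β * orbit x k)

  -- I lies in [-1, 1], because `l = inv - 1` and `r = 1 - β * inv`. Squares take the place of
  -- absolute values in the estimates.
  ∈I⇒x²≤1 : ∀ {x} → x ∈I → x * x ≤ 1#
  ∈I⇒x²≤1 {x} (l≤x , x<r) = ≤-+ (0≤x*y 0≤1+x 0≤1-x)
    (solve 1 (λ x → con (+ 1) := x :* x :+ (con (+ 1) :+ x) :* (con (+ 1) :+ :- x)) refl x)
    where
    0≤1+x : 0# ≤ 1# + x
    0≤1+x = ≤-trans (0≤x+y (x≤y⇒0≤y-x l≤x) (inj₁ 0<inv)) (inj₂ (begin-equality
      (x - l) + inv         ≈⟨ +-congˡ (trans l+1≈r (*-identityˡ inv)) ⟨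
      (x - l) + (l + 1#)  ≈⟨ solve 2 (λ x l → (x :+ :- l) :+ (l :+ con (+ 1)) := con (+ 1) :+ x) refl x l ⟩
      1# + x              ∎))
    0≤1-x : 0# ≤ 1# - x
    0≤1-x = ≤-trans (0≤x+y (x≤y⇒0≤y-x (inj₁ x<r)) (inj₁ (*-pos 0<β 0<inv))) (inj₂ (begin-equality
      (r - x) + β * inv
        ≈⟨ solve 3 (λ inv x β → (con (+ 1) :* inv :+ :- x) :+ β :* inv := (β :+ con (+ 1)) :* inv :+ :- x)
             refl inv x β ⟩
      (β + 1#) * inv - x          ≈⟨ +-congʳ [β+1]*inv≈1 ⟩
      1# - x                    ∎))

  digit²-bound : Carrier
  digit²-bound = (1# + 1#) * (β * β) + (1# + 1#)

  -- The digit is `−βx − T x`, and `(a − b)² ≤ 2a² + 2b²`, where both `x²` and `(T x)²` are at most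
  -- one.
  digit²≤ : ∀ {x} → x ∈I → fromℤ (digit x) * fromℤ (digit x) ≤ digit²-bound
  digit²≤ {x} x∈I = ≤-+
    (0≤x+y (0≤x+y (0≤x² (- β * x + t)) (0≤x*y (0≤x*y 0≤2 (0≤x² β)) (x≤y⇒0≤y-x (∈I⇒x²≤1 x∈I))))
      (0≤x*y 0≤2 (x≤y⇒0≤y-x (∈I⇒x²≤1 (orbit-∈I x∈I 1)))))
    (solve 3 (λ β x k →
       let two = con (+ 1) :+ con (+ 1)
           t = :- β :* x :+ :- k
       in two :* (β :* β) :+ two :=
          k :* k :+
          (((:- β :* x :+ t) :* (:- β :* x :+ t) :+ two :* (β :* β) :* (con (+ 1) :+ :- (x :* x))) :+
           two :* (con (+ 1) :+ :- (t :* t))))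
     refl β x (fromℤ (digit x)))
    where t = T x

  0<β²-1 : 0# < β * β - 1#
  0<β²-1 = <-≤-trans (*-pos (x<y⇒0<y-x 1<β) (0<x+y 0<β (inj₁ 0<1)))
    (inj₂ (solve 1 (λ β → (β :+ :- con (+ 1)) :* (β :+ con (+ 1)) := β :* β :+ :- con (+ 1)) refl β))

  periodic-digits⇒periodic-orbit : ∀ {x m p} → x ∈I → (∀ n → m ℕ.≤ n → d x (n ℕ.+ p) ≡ d x n) →
                                   orbit x (m ℕ.+ p) ≈ orbit x m
  periodic-digits⇒periodic-orbit {x} {m} {p} x∈I periodic = x-y≈0⇒x≈y δ₀≈0
    where
    u v δ : ℕ → Carrier
    -- With `k` added on the left, passing to `suc k` is one application of `T` by computation.
    u k = orbit x (k ℕ.+ m ℕ.+ p)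
    v k = orbit x (k ℕ.+ m)
    δ k = u k - v k

    δ-suc : ∀ k → δ (suc k) ≈ - β * δ k
    δ-suc k = begin-equality
      (- β * u k - fromℤ (d x (k ℕ.+ m ℕ.+ p))) - (- β * v k - fromℤ (d x (k ℕ.+ m)))
        ≡⟨ ≡.cong (λ j → (- β * u k - fromℤ j) - (- β * v k - fromℤ (d x (k ℕ.+ m))))
             (periodic (k ℕ.+ m) (ℕ.m≤n+m m k)) ⟩
      (- β * u k - fromℤ (d x (k ℕ.+ m))) - (- β * v k - fromℤ (d x (k ℕ.+ m)))
        ≈⟨ solve 4 (λ β u v j → (:- β :* u :+ :- j) :+ :- (:- β :* v :+ :- j) := :- β :* (u :+ :- v))
             refl β (u k) (v k) (fromℤ (d x (k ℕ.+ m))) ⟩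
      - β * δ k ∎

    δ² : ℕ → Carrier
    δ² k = δ k * δ k

    -- Squaring removes the alternating sign; the factor `β²` is written as `1 + (β² − 1)` to match
    -- `geometric-unbounded`.
    δ²-suc : ∀ k → δ² (suc k) ≈ δ² k + (β * β - 1#) * δ² k
    δ²-suc k = trans (*-cong (δ-suc k) (δ-suc k))
      (solve 2 (λ β δ → (:- β :* δ) :* (:- β :* δ) := δ :* δ :+ (β :* β :+ :- con (+ 1)) :* (δ :* δ)) refl β (δ k))

    4# = (1# + 1#) + (1# + 1#)

    -- From `(u − v)² + (u + v)² = 2u² + 2v²` with both points in I.
    δ²≤4 : ∀ k → δ² k ≤ 4#
    δ²≤4 k = ≤-+
      (0≤x+y (0≤x² (u k + v k)) (0≤x*y 0≤2 (0≤x+y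
        (x≤y⇒0≤y-x (∈I⇒x²≤1 (orbit-∈I x∈I (k ℕ.+ m ℕ.+ p))))
        (x≤y⇒0≤y-x (∈I⇒x²≤1 (orbit-∈I x∈I (k ℕ.+ m)))))))
      (solve 2 (λ u v →
         let two = con (+ 1) :+ con (+ 1) in
         two :+ two :=
         (u :+ :- v) :* (u :+ :- v) :+
         ((u :+ v) :* (u :+ v) :+ two :* ((con (+ 1) :+ :- (u :* u)) :+ (con (+ 1) :+ :- (v :* v)))))
       refl (u k) (v k))

    δ₀≈0 : δ 0 ≈ 0#
    δ₀≈0 = ≉0-stable λ δ₀≉0 →
      let k , 4<δ² = geometric-unbounded {s = δ²} 0<β²-1 (≉⇒0<² δ₀≉0) δ²-suc 4#
      in ≤⇒≯ (δ²≤4 k) 4<δ²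

-- Integrality of β from the orbit of the left endpoint

module Integrality (em : ExcludedMiddle 0ℓ) (ℝ : CompleteOrderedField)
                   (β : CompleteOrderedField.Carrier ℝ)
                   (1<β : CompleteOrderedField._<_ ℝ (CompleteOrderedField.1# ℝ) β) where
  open CompleteOrderedField ℝ
  open OrderedField ℝ
  open AlgebraicNumbers ℝ
  open NegativeBase em ℝ β
  open Expansion em ℝ β 1<β
  open IntegerCoefficients commutativeRing
  open Exponentiation semiring using (_^_)
  open Evaluation rawRing using (eval)
  open Horner ℤ.+-*-rawRing commutativeRing fromℤ-homomorphism β
  open StrictReasoning (StrictTotalOrder.strictPartialOrder strictTotalOrder)
  private module ℤ→ℝ = _-Raw-AlmostCommutative⟶_ fromℤ-homomorphism

  isValue-+ : ∀ {n u w} → IsValue n u → IsValue n w → IsValue n (u + w)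
  isValue-+ {u = u} {w} vu vw = isValue-resp
    (+-congˡ (trans (*-congʳ (+-identityʳ 1#)) (*-identityˡ w))) (isValue-addMultiple (+ 1) vu vw)

  isValue-neg : ∀ {n u} → IsValue n u → IsValue n (- u)
  isValue-neg {n} {u} vu = isValue-resp
    (trans (+-congˡ (*-congʳ (-‿cong (+-identityʳ 1#))))
      (solve 1 (λ u → con (+ 0) :+ :- con (+ 1) :* u := :- u) refl u))
    (isValue-addMultiple (ℤ.- + 1) (isValue-zero n) vu)

  isAlgebraicInteger : ∀ n → IsValue n (- β ^ n) → IsAlgebraicInteger β
  isAlgebraicInteger n (v , -βⁿ≈v) = n , v , (begin-equality
    eval fromℤ v β    ≈⟨ eval≈horner v ⟩
    horner v + β ^ n  ≈⟨ +-congʳ -βⁿ≈v ⟨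
    - β ^ n + β ^ n   ≈⟨ -‿inverseˡ _ ⟩
    0#                ∎)

  -- Up to sign, `u` is a monic integer polynomial of degree `n` in `β`: subtracting the leading
  -- power leaves degree below `n`. The sign is left open because it alternates along the orbit.
  IsSignedMonicValue : ℕ → Carrier → Set
  IsSignedMonicValue n u = IsValue n (u - β ^ n) ⊎ IsValue n (- u - β ^ n)

  isSignedMonicValue⇒isValue : ∀ {n u} → IsSignedMonicValue n u → IsValue (suc n) u
  isSignedMonicValue⇒isValue {n} {u} (inj₁ low) = isValue-resp
    (solve 2 (λ u y → (u :+ :- y) :+ y := u) refl u (β ^ n))
    (isValue-+ (isValue-mono (ℕ.n≤1+n n) low) (isValue-^ n))
  isSignedMonicValue⇒isValue {n} {u} (inj₂ low) = isValue-resp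
    (solve 2 (λ u y → :- ((:- u :+ :- y) :+ y) := u) refl u (β ^ n))
    (isValue-neg (isValue-+ (isValue-mono (ℕ.n≤1+n n) low) (isValue-^ n)))

  -- Cancelling `u` between its two representations expresses `βⁿ` through lower powers with integer
  -- coefficients.
  relation⇒isAlgebraicInteger : ∀ {n u} → IsSignedMonicValue n u → IsValue n u → IsAlgebraicInteger β
  relation⇒isAlgebraicInteger {n} {u} (inj₁ low) vu = isAlgebraicInteger n (isValue-resp
    (solve 2 (λ u y → (u :+ :- y) :+ :- u := :- y) refl u (β ^ n)) (isValue-+ low (isValue-neg vu)))
  relation⇒isAlgebraicInteger {n} {u} (inj₂ low) vu = isAlgebraicInteger n (isValue-resp
    (solve 2 (λ u y → (:- u :+ :- y) :+ u := :- y) refl u (β ^ n)) (isValue-+ low vu))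

  isValue-addLinear : ∀ {n w} k → IsValue (suc n) w → IsValue (suc (suc n)) (fromℤ k + β * (fromℤ k + w))
  isValue-addLinear k vw = isValue-cons k (isValue-addConstant k vw)

  -- With `k` the digit, `- T t * (β + 1)` is `k + β * (k + t * (β + 1))`. So the degree rises by
  -- one and the sign flips, while the digit contributes only `k * (β + 1)`, of degree at most one
  -- and hence below the new degree `n + 2`.
  T-isSignedMonicValue : ∀ {n} t → IsSignedMonicValue (suc n) (t * (β + 1#)) →
                         IsSignedMonicValue (suc (suc n)) (T t * (β + 1#))
  T-isSignedMonicValue {n} t (inj₁ low) = inj₂ (isValue-resp
    (solve 4 (λ β t k y →
       k :+ β :* (k :+ (t :* (β :+ con (+ 1)) :+ :- y)) :=
       :- ((:- β :* t :+ :- k) :* (β :+ con (+ 1))) :+ :- (β :* y))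
     refl β t (fromℤ (digit t)) (β ^ suc n))
    (isValue-addLinear (digit t) low))
  T-isSignedMonicValue {n} t (inj₂ low) = inj₁ (isValue-resp
    (trans (+-cong (ℤ→ℝ.-‿homo (digit t)) (*-congˡ (+-congʳ (ℤ→ℝ.-‿homo (digit t)))))
      (solve 4 (λ β t k y →
         :- k :+ β :* (:- k :+ (:- (t :* (β :+ con (+ 1))) :+ :- y)) :=
         (:- β :* t :+ :- k) :* (β :+ con (+ 1)) :+ :- (β :* y))
       refl β t (fromℤ (digit t)) (β ^ suc n)))
    (isValue-addLinear (ℤ.- digit t) low))

  orbit-isSignedMonicValue : ∀ k → IsSignedMonicValue (suc k) (orbit l k * (β + 1#))
  -- As `(β + 1) l = −β`, the negative sign applies and the part below the leading power is zero.
  orbit-isSignedMonicValue zero = inj₂ (isValue-resp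
    (sym (trans (+-congʳ (-‿cong l*[β+1]≈-β))
      (solve 1 (λ β → :- :- β :+ :- (β :* con (+ 1)) := con (+ 0)) refl β)))
    (isValue-zero 1))
  orbit-isSignedMonicValue (suc k) = T-isSignedMonicValue (orbit l k) (orbit-isSignedMonicValue k)

  eventuallyPeriodic⇒isAlgebraicInteger : EventuallyPeriodic (d l) → IsAlgebraicInteger β
  eventuallyPeriodic⇒isAlgebraicInteger (m , suc p , _ , periodic) =
    relation⇒isAlgebraicInteger {suc (m ℕ.+ suc p)} (orbit-isSignedMonicValue (m ℕ.+ suc p))
      (isValue-resp (*-congʳ (sym (periodic-digits⇒periodic-orbit l∈I periodic)))
        -- A positive period puts the degree `m + 1` of the earlier point strictly below the degree
        -- attained at the later one, so the relation is nontrivial.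
        (isValue-mono (s≤s m<m+1+p) (isSignedMonicValue⇒isValue (orbit-isSignedMonicValue m))))
    where
    m<m+1+p : suc m ℕ.≤ m ℕ.+ suc p
    m<m+1+p = ≡.subst (suc m ℕ.≤_) (≡.sym (ℕ.+-suc m p)) (s≤s (ℕ.m≤m+n m p))

-- Real elements of subfields of ℂ

module FieldMembership (ℝ : CompleteOrderedField) where
  open CompleteOrderedField ℝ
  open OrderedField ℝ
  open ComplexNumbers ℝ
  open ComplexRing ℝ
  private module r = _-Raw-AlmostCommutative⟶_ fromReal-homomorphism

  module _ {K : ℂ.Carrier → Set} (isSubfield : IsSubfield K) where
    open IsSubfield isSubfield
    private module ℂᶜ = CommutativeRing ℂ-commutativeRing

    fromReal-+∈ : ∀ {x y} → K (fromReal x) → K (fromReal y) → K (fromReal (x + y))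
    fromReal-+∈ {x} {y} Kx Ky = resp-≈ (ℂᶜ.sym (r.+-homo x y)) (+-closed Kx Ky)

    fromReal-*∈ : ∀ {x y} → K (fromReal x) → K (fromReal y) → K (fromReal (x * y))
    fromReal-*∈ {x} {y} Kx Ky = resp-≈ (ℂᶜ.sym (r.*-homo x y)) (*-closed Kx Ky)

    fromReal-neg∈ : ∀ {x} → K (fromReal x) → K (fromReal (- x))
    fromReal-neg∈ {x} Kx = resp-≈ (ℂᶜ.sym (r.-‿homo x)) (neg-closed Kx)

    fromReal-⁻¹∈ : ∀ {x} → ¬ x ≈ 0# → K (fromReal x) → K (fromReal (x ⁻¹))
    fromReal-⁻¹∈ {x} x≉0 = inv-closed (ℂᶜ.trans (ℂᶜ.sym (r.*-homo x (x ⁻¹))) (*-⁻¹ x≉0 , refl))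

    fromℕ∈ : ∀ n → K (fromReal (fromℕ n))
    fromℕ∈ zero    = 0∈
    fromℕ∈ (suc n) = fromReal-+∈ 1∈ (fromℕ∈ n)

    fromℤ∈ : ∀ i → K (fromReal (fromℤ i))
    fromℤ∈ (+ n)    = fromℕ∈ n
    fromℤ∈ -[1+ n ] = fromReal-neg∈ (fromℕ∈ (suc n))

-- Norm estimates for one step of the conjugate orbit

module Escape (ℝ : CompleteOrderedField) where
  open CompleteOrderedField ℝ
  open OrderedFieldProperties ℝ
  open OrderedField ℝ
  open ComplexNumbers ℝ
  open IntegerCoefficients commutativeRing
  open StrictReasoning (StrictTotalOrder.strictPartialOrder strictTotalOrder)

  ∥_∥² : ℂ.Carrier → Carrier
  ∥ a , b ∥² = a * a + b * b

  -- The modulus is the least upper bound of the `t` with `t² ≤ ∥ z ∥²`, so it suffices that `1` is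
  -- an upper bound; and `1 < t` would give `1 < t < t²`.
  ∥∥²≤1⇒∣∣≤1 : ∀ {z} → ∥ z ∥² ≤ 1# → ∣ z ∣ ≤ 1#
  ∥∥²≤1⇒∣∣≤1 ∥z∥²≤1 = proj₂ (proj₂ (complete _ _ _)) 1# λ t t²≤∥z∥² → ≮⇒≥ λ 1<t →
    ≤⇒≯ (≤-trans t²≤∥z∥² ∥z∥²≤1)
      (<-trans 1<t (<-+ (*-pos (<-trans 0<1 1<t) (x<y⇒0<y-x 1<t))
        (solve 1 (λ t → t :* t := t :+ t :* (t :+ :- con (+ 1))) refl t)))

  ∥∥²-cong : ∀ {z w} → z ℂ.≈ w → ∥ z ∥² ≈ ∥ w ∥²
  ∥∥²-cong (p , q) = +-cong (*-cong p p) (*-cong q q)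

  0<∥z∥² : ∀ {z} → ¬ z ℂ.≈ ℂ.0# → 0# < ∥ z ∥²
  0<∥z∥² {a , b} z≉0 = ≰⇒> λ ∥z∥²≤0 → z≉0
    ( ≉0-stable (λ a≉0 → ≤⇒≯ ∥z∥²≤0 (0<x+y (≉⇒0<² a≉0) (0≤x² b)))
    , ≉0-stable (λ b≉0 → ≤⇒≯ ∥z∥²≤0 (<-≤-trans (0<x+y (≉⇒0<² b≉0) (0≤x² a)) (inj₂ (+-comm _ _)))) )

  -- The map `z ↦ −γz − k` for real `k`, in real and imaginary parts.
  transform : ℂ.Carrier → Carrier → ℂ.Carrier → ℂ.Carrier
  transform (g , h) k (a , b) = - (g * a + - (h * b)) + - k , - (g * b + h * a)

  excess : ℂ.Carrier → Carrier
  excess γ = ∥ γ ∥² - 1#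

  threshold : Carrier → Carrier → Carrier
  threshold e C = ((1# + 1#) * (1# + 1#) + (1# + 1#) * e) * C

  -- For u = −γz − k, the failure of the conclusion contradicts e²(Im u)² + (e Re u − 2k)² ≥ 0.
  escape : ∀ {C k} γ z → let e = excess γ in
           0# ≤ e → k * k ≤ C → threshold e C < e * e * ∥ z ∥² →
           ∥ z ∥² < ∥ transform γ k z ∥²
  escape {C} {k} γ@(g , h) z@(a , b) 0≤e k²≤C above = ≰⇒> λ U≤Z →
    ≤⇒≯ (≤-+ (0≤x+y (0≤x+y (0≤x*y 0≤4+2e (x≤y⇒0≤y-x k²≤C))
                           (0≤x*y (0≤x*y 0≤e (0≤x+y 0≤2 0≤e)) (x≤y⇒0≤y-x U≤Z)))
                    (0≤x+y (0≤x*y (0≤x² e) (0≤x² v)) (0≤x² (e * u - 2# * k))))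
             (begin-equality
               threshold e C
                 -- `U` is the squared norm of the image and `W` that of `−γz`. The final multiple
                 -- of `W − (1 + e) Z` is zero and is dropped in the next step; every other slack
                 -- term is nonnegative.
                 ≈⟨ solve 6 (λ e C k u v Z →
                      let two = con (+ 1) :+ con (+ 1)
                          U = u :* u :+ v :* v
                          W = (u :+ k) :* (u :+ k) :+ v :* v
                          w = e :* u :+ :- (two :* k)
                      in (two :* two :+ two :* e) :* C :=
                         (e :* e :* Z :+
                          (((two :* two :+ two :* e) :* (C :+ :- (k :* k)) :+ e :* (two :+ e) :* (Z :+ :- U)) :+
                           (e :* e :* (v :* v) :+ w :* w)))
                         :+ two :* e :* (W :+ :- ((con (+ 1) :+ e) :* Z)))
                      refl e C k u v (∥ z ∥²) ⟩
               (e * e * ∥ z ∥² + _) + 2# * e * (((u + k) * (u + k) + v * v) - (1# + e) * ∥ z ∥²)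
                 ≈⟨ +-congˡ (trans (*-congˡ W≈[1+e]Z) (zeroʳ _)) ⟩
               (e * e * ∥ z ∥² + _) + 0#
                 ≈⟨ +-identityʳ _ ⟩
               e * e * ∥ z ∥² + _ ∎))
        above
    where
    2# = 1# + 1#
    e = excess γ
    u = proj₁ (transform γ k z)
    v = proj₂ (transform γ k z)

    0≤4+2e : 0# ≤ 2# * 2# + 2# * e
    0≤4+2e = 0≤x+y (0≤x*y 0≤2 0≤2) (0≤x*y 0≤2 0≤e)

    -- Multiplicativity of the squared norm: `u + k` and `v` are the parts of `−γz`, and `1 + e` is
    -- the squared norm of `γ`.
    W≈[1+e]Z : ((u + k) * (u + k) + v * v) - (1# + e) * ∥ z ∥² ≈ 0#
    W≈[1+e]Z = solve 5 (λ g h a b k →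
      let u = :- (g :* a :+ :- (h :* b)) :+ :- k
          v = :- (g :* b :+ h :* a)
      in ((u :+ k) :* (u :+ k) :+ v :* v) :+
         :- ((con (+ 1) :+ ((g :* g :+ h :* h) :+ :- con (+ 1))) :* (a :* a :+ b :* b)) := con (+ 0))
      refl g h a b k

  -- 2∥na + x, nb∥² + 2x² ≥ n²(a² + b²), and x² ≤ 1.
  far-away : ∀ {e D a b x y z} n → 0# < e → x * x ≤ 1# →
             (1# + 1#) * (D + e * e) < fromℕ n * (e * e * (a * a + b * b)) →
             y ≈ fromℕ n * a + x → z ≈ fromℕ n * b → D < e * e * ∥ y , z ∥²
  far-away {e} {D} {a} {b} {x} {y} {z} n 0<e x²≤1 large y≈ z≈ = *-cancelˡ-< 0≤2
    (<-+ (0<x+y (0<x+y (x<y⇒0<y-x large)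
                       (0≤x*y (x≤y⇒0≤y-x (n≤n² n)) (0≤x*y (0≤x² e) (0≤x+y (0≤x² a) (0≤x² b)))))
                (0≤x+y (0≤x*y (0≤x² e) (0≤x+y (0≤x² _) (0≤x² (fromℕ n * b))))
                       (0≤x*y (0≤x*y 0≤2 (0≤x² e)) (x≤y⇒0≤y-x x²≤1))))
      (trans (*-congˡ (*-congˡ (∥∥²-cong (y≈ , z≈))))
        (solve 6 (λ n e D a b x →
           let two = con (+ 1) :+ con (+ 1)
               Y = n :* a :+ x
               Z = n :* b
               ω = a :* a :+ b :* b
               -- `X` and `Z` are the parts of the discarded square, from
               -- `2(na + x)² + 2x² = (na)² + (na + 2x)²`.
               X = n :* a :+ two :* x
           in two :* (e :* e :* (Y :* Y :+ Z :* Z)) :=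
              two :* D :+
              (((n :* (e :* e :* ω) :+ :- (two :* (D :+ e :* e))) :+
                (n :* n :+ :- n) :* (e :* e :* ω)) :+
               (e :* e :* (X :* X :+ Z :* Z) :+
                two :* (e :* e) :* (con (+ 1) :+ :- (x :* x)))))
         refl (fromℕ n) e D a b x)))
    where
    -- The Archimedean property gives a bound linear in `n`, whereas the squared norm involves `n²`.
    n≤n² : ∀ n → fromℕ n ≤ fromℕ n * fromℕ n
    n≤n² zero    = inj₂ (sym (zeroˡ 0#))
    n≤n² (suc n) = ≤-+ (0≤x*y (0≤fromℕ (suc n)) (0≤fromℕ n))
      (solve 1 (λ m → (con (+ 1) :+ m) :* (con (+ 1) :+ m) :=
                      (con (+ 1) :+ m) :+ (con (+ 1) :+ m) :* m) refl (fromℕ n))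

-- Conjugate orbits and the bound on the other conjugates

module OtherConjugates (em : ExcludedMiddle 0ℓ) (ℝ : CompleteOrderedField)
                       (β : CompleteOrderedField.Carrier ℝ)
                       (1<β : CompleteOrderedField._<_ ℝ (CompleteOrderedField.1# ℝ) β) where
  open CompleteOrderedField ℝ
  open OrderedFieldProperties ℝ using (0≤x²; ≮⇒≥; -0#≈0#)
  open OrderedField ℝ
  open ComplexNumbers ℝ
  open ComplexRing ℝ
  open AlgebraicNumbers ℝ
  open Conjugation ℝ
  open Floor em ℝ
  open Growth em ℝ
  open NegativeBase em ℝ β
  open Expansion em ℝ β 1<β
  open FieldMembership ℝ
  open Escape ℝ
  open Integrality em ℝ β 1<β using (eventuallyPeriodic⇒isAlgebraicInteger)
  open IntegerCoefficients commutativeRing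
  private module ℂᶜ = CommutativeRing ℂ-commutativeRing

  module _ {γ : ℂ.Carrier} {n} (p : Monic ℚ n) (pβ : IsMinimalPolynomial p β)
           (pγ≈0 : Evaluation.eval ℂ (fromReal ∘ fromℚ) p γ ℂ.≈ ℂ.0#) where
    private
      _↔_ : Carrier → ℂ.Carrier → Set
      _↔_ = Conjugates p pβ pγ≈0

    -- `T u` is `0 − (k + β u)` with `k` the digit of `u`, and the integer `k` is its own conjugate.
    conjugates-T : ∀ {u z} → u ↔ z → T u ↔ transform γ (fromℤ (digit u)) z
    conjugates-T {u} {z} u↔z = conjugates-resp p pβ pγ≈0
      (trans (+-congˡ (-‿cong (+-congʳ (fromℚ-integer k))))
        (solve 3 (λ β u k → con (+ 0) :+ :- (k :+ β :* u) := :- β :* u :+ :- k) refl β u (fromℤ k)))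
      ( trans (+-congˡ (-‿cong (+-congʳ (fromℚ-integer k))))
          (solve 2 (λ k w → con (+ 0) :+ :- (k :+ w) := :- w :+ :- k) refl (fromℤ k) (proj₁ (γ ℂ.* z)))
      , solve 1 (λ w → con (+ 0) :+ :- (con (+ 0) :+ w) := :- w) refl (proj₂ (γ ℂ.* z)) )
      (conjugates-minus p pβ pγ≈0 (conjugates-zero p pβ pγ≈0) (conjugates-cons p pβ pγ≈0 (integer k) u↔z))
      where k = digit u

    -- Built as `−j + β (m + β 0)`, so that the reduction in `conjugates-cons` handles every degree
    -- of `p`, including one.
    conjugates-linear : ∀ m j → (fromℤ m * β - fromℤ j) ↔ (fromℤ m * proj₁ γ - fromℤ j , fromℤ m * proj₂ γ)
    conjugates-linear m j = conjugates-resp p pβ pγ≈0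
      (trans (+-cong -j≈ (*-congˡ (+-congʳ (fromℚ-integer m))))
        (solve 3 (λ β m j → :- j :+ β :* (m :+ β :* con (+ 0)) := m :* β :+ :- j)
          refl β (fromℤ m) (fromℤ j)))
      (ℂᶜ.trans (ℂᶜ.+-cong {x = fromReal (fromℚ (integer (ℤ.- j)))} {y = fromReal (- fromℤ j)}
                  (-j≈ , refl) (ℂᶜ.*-congˡ {γ} (ℂᶜ.+-congʳ {γ ℂ.* ℂ.0#} (fromℚ-integer m , refl))))
        ( solve 4 (λ g h m j →
            :- j :+ (g :* (m :+ (g :* con (+ 0) :+ :- (h :* con (+ 0)))) :+
                     :- (h :* (con (+ 0) :+ (g :* con (+ 0) :+ h :* con (+ 0))))) :=
            m :* g :+ :- j) refl (proj₁ γ) (proj₂ γ) (fromℤ m) (fromℤ j)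
        , solve 3 (λ g h m →
            con (+ 0) :+ (g :* (con (+ 0) :+ (g :* con (+ 0) :+ h :* con (+ 0))) :+
                          h :* (m :+ (g :* con (+ 0) :+ :- (h :* con (+ 0))))) :=
            m :* h) refl (proj₁ γ) (proj₂ γ) (fromℤ m) ))
      (conjugates-cons p pβ pγ≈0 (integer (ℤ.- j))
        (conjugates-cons p pβ pγ≈0 (integer m) (conjugates-zero p pβ pγ≈0)))
      where
      -j≈ : fromℚ (integer (ℤ.- j)) ≈ - fromℤ j
      -j≈ = trans (fromℚ-integer (ℤ.- j)) (_-Raw-AlmostCommutative⟶_.-‿homo fromℤ-homomorphism j)

    -- The digits are those of the real point `x`; no floor is taken on the conjugate side.
    conjugateOrbit : Carrier → ℂ.Carrier → ℕ → ℂ.Carrier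
    conjugateOrbit x z zero    = z
    conjugateOrbit x z (suc k) = transform γ (fromℤ (d x k)) (conjugateOrbit x z k)

    conjugates-orbit : ∀ {x z} → x ↔ z → ∀ k → orbit x k ↔ conjugateOrbit x z k
    conjugates-orbit x↔z zero    = x↔z
    conjugates-orbit x↔z (suc k) = conjugates-T (conjugates-orbit x↔z k)

    module _ {x z} (x∈I : x ∈I) (x↔z : x ↔ z) (0<e : 0# < excess γ)
             (large : threshold (excess γ) digit²-bound < excess γ * excess γ * ∥ z ∥²) where
      private
        w : ℕ → ℂ.Carrier
        w = conjugateOrbit x z

      w-escape : ∀ k → threshold (excess γ) digit²-bound < excess γ * excess γ * ∥ w k ∥² →
                 ∥ w k ∥² < ∥ w (suc k) ∥²
      w-escape k = escape {digit²-bound} {fromℤ (d x k)} γ (w k) (inj₁ 0<e) (digit²≤ {orbit x k} (orbit-∈I x∈I k))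

      -- Both claims go into one induction: an increase keeps the next point above the threshold,
      -- and being above it forces the next increase.
      conjugateOrbit-step : ∀ k →
        threshold (excess γ) digit²-bound < excess γ * excess γ * ∥ w k ∥² × ∥ w k ∥² < ∥ w (suc k) ∥²
      conjugateOrbit-step zero    = large , w-escape 0 large
      conjugateOrbit-step (suc k) =
        let above , increase = conjugateOrbit-step k
            above′ = <-≤-trans above (*-monoˡ-≤ {∥ w k ∥²} {∥ w (suc k) ∥²} (0≤x² (excess γ)) (inj₁ increase))
        in above′ , w-escape (suc k) above′

      conjugateOrbit-increasing : ∀ m k → ∥ w m ∥² < ∥ w (suc k ℕ.+ m) ∥²
      conjugateOrbit-increasing m zero    = proj₂ (conjugateOrbit-step m)
      conjugateOrbit-increasing m (suc k) = <-trans {∥ w m ∥²} {∥ w (suc k ℕ.+ m) ∥²}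
        (conjugateOrbit-increasing m k) (proj₂ (conjugateOrbit-step (suc k ℕ.+ m)))

      -- The real orbit would return to an earlier point, and as conjugates are unique the conjugate
      -- orbit would return with it, against the strict growth of its norm.
      ¬eventuallyPeriodic : ¬ EventuallyPeriodic (d x)
      ¬eventuallyPeriodic (m , suc k , _ , periodic) =
        <-irrefl (sym (∥∥²-cong {w (m ℕ.+ suc k)} {w m} wₙ≈wₘ))
          (≡.subst (λ n → ∥ w m ∥² < ∥ w n ∥²) (ℕ.+-comm (suc k) m) (conjugateOrbit-increasing m k))
        where
        difference≈0 : w (m ℕ.+ suc k) ℂ.+ ℂ.- w m ℂ.≈ ℂ.0#
        difference≈0 = conjugates-of-zero p pβ pγ≈0
          (conjugates-minus p pβ pγ≈0 (conjugates-orbit x↔z (m ℕ.+ suc k)) (conjugates-orbit x↔z m))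
          (trans (+-congʳ (periodic-digits⇒periodic-orbit x∈I periodic)) (-‿inverseʳ _))
        wₙ≈wₘ : w (m ℕ.+ suc k) ℂ.≈ w m
        wₙ≈wₘ = x-y≈0⇒x≈y (proj₁ difference≈0) , x-y≈0⇒x≈y (proj₂ difference≈0)

  module _ (periodic : ∀ x → x ∈I → fromReal x ∈ℚ⟨ fromReal β ⟩ → EventuallyPeriodic (d x)) where

    l∈ℚ⟨β⟩ : fromReal l ∈ℚ⟨ fromReal β ⟩
    l∈ℚ⟨β⟩ K isSubfield Kβ = fromReal-neg∈ isSubfield
      (fromReal-*∈ isSubfield Kβ (fromReal-⁻¹∈ isSubfield β+1≉0
        (fromReal-+∈ isSubfield Kβ (IsSubfield.1∈ isSubfield))))

    l-eventuallyPeriodic : EventuallyPeriodic (d l)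
    l-eventuallyPeriodic = periodic l l∈I l∈ℚ⟨β⟩

    isInteger : IsAlgebraicInteger β
    isInteger = eventuallyPeriodic⇒isAlgebraicInteger l-eventuallyPeriodic

    nβ-j∈ℚ⟨β⟩ : ∀ n j → fromReal (fromℕ n * β - fromℤ j) ∈ℚ⟨ fromReal β ⟩
    nβ-j∈ℚ⟨β⟩ n j K isSubfield Kβ = fromReal-+∈ isSubfield
      (fromReal-*∈ isSubfield (fromℕ∈ isSubfield n) Kβ)
      (fromReal-neg∈ isSubfield (fromℤ∈ isSubfield j))

    -- The points nβ − j of I have conjugates n(γ − β) + (nβ − j), which are unbounded.
    otherConjugate-∣∣≤1 : ∀ γ → IsOtherConjugate γ β → ∣ γ ∣ ≤ 1#
    otherConjugate-∣∣≤1 γ ((_ , p , pβ , pγ≈0) , γ≉β) = ∥∥²≤1⇒∣∣≤1 (≮⇒≥ ¬1<∥γ∥²)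
      where
      γ-β = γ ℂ.+ ℂ.- fromReal β

      γ-β≉0 : ¬ γ-β ℂ.≈ ℂ.0#
      γ-β≉0 (eq₁ , eq₂) = γ≉β (x-y≈0⇒x≈y eq₁ , x-y≈0⇒x≈y eq₂)

      e D : Carrier
      e = excess γ
      D = threshold e digit²-bound

      ¬1<∥γ∥² : ¬ 1# < ∥ γ ∥²
      ¬1<∥γ∥² 1<∥γ∥² = ¬eventuallyPeriodic p pβ pγ≈0 {x} {z} x∈I
        (conjugates-linear p pβ pγ≈0 (+ n) j) 0<e far (periodic x x∈I (nβ-j∈ℚ⟨β⟩ n j))
        where
        0<e : 0# < e
        0<e = x<y⇒0<y-x 1<∥γ∥²

        large : ∃ λ n → (1# + 1#) * (D + e * e) < fromℕ n * (e * e * ∥ γ-β ∥²)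
        -- The factor of `n` is positive because `γ` differs from `β`. The extra `e * e` on the left
        -- pays for the term `2x²`, at most two, in `far-away`.
        large = archimedean-* (*-pos (*-pos 0<e 0<e) (0<∥z∥² γ-β≉0)) ((1# + 1#) * (D + e * e))

        n : ℕ
        n = proj₁ large

        j : ℤ
        j = ⌊ fromℕ n * β - l ⌋

        x : Carrier
        x = fromℕ n * β - fromℤ j

        z : ℂ.Carrier
        z = fromℕ n * proj₁ γ - fromℤ j , fromℕ n * proj₂ γ

        x∈I : x ∈I
        x∈I = y-⌊y-l⌋∈I (fromℕ n * β)

        far : D < e * e * ∥ z ∥²
        far = far-away {e} {D} {proj₁ γ-β} {proj₂ γ-β} {x} {proj₁ z} {proj₂ z} n 0<e
          (∈I⇒x²≤1 {x} x∈I) (proj₂ large)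
          (solve 4 (λ n g β j → n :* g :+ :- j := n :* (g :+ :- β) :+ (n :* β :+ :- j))
            refl (fromℕ n) (proj₁ γ) β (fromℤ j))
          (*-congˡ (sym (trans (+-congˡ -0#≈0#) (+-identityʳ _))))

    -- A Salem number is by definition not Pisot, so excluded middle on `IsPisot β` provides the
    -- remaining condition in the second case.
    isPisot⊎isSalem : IsPisot β ⊎ IsSalem β
    isPisot⊎isSalem = map₂ (λ ¬pisot → isInteger , 1<β , otherConjugate-∣∣≤1 , ¬pisot)
      (toSum (em {P = IsPisot β}))

theorem3 : (em : ExcludedMiddle 0ℓ) (ℝ : CompleteOrderedField) →
    let open CompleteOrderedField ℝ
        open ComplexNumbers ℝ
        open AlgebraicNumbers ℝ
    in (β : Carrier) → 1# < β →
       let open NegativeBase em ℝ β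
       in (∀ x → x ∈I → fromReal x ∈ℚ⟨ fromReal β ⟩ → EventuallyPeriodic (d x)) →
          IsPisot β ⊎ IsSalem β
theorem3 em ℝ β 1<β = isPisot⊎isSalem
  where open OtherConjugates em ℝ β 1<β
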